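{- Let $L$ be a Latin square of order $n \geq 3$. Let $p_{\max}$ be the number of maximal partial transversals of deficit $1$ in $L$, let $q_{\min}$ be the number of minimal $(n+1)$-covers of $L$, and let $q_1,\dots,q_5$ be as defined in the context. Then $q_{\min} = q_1 + q_2 + q_3 + q_5$ and $$0 \leq \frac{2(q_{\min}-q_1)}{3n-4} \leq p_{\max} \leq \frac{2(q_{\min}-q_1)}{3n-6} \leq \frac{2q_{\min}}{3n-6}.$$ Moreover, if $t$ is the number of transversals of $L$, $p$ is the number of (not necessarily maximal) partial transversals of deficit $1$ of $L$, and $q$ is the number of (not necessarily minimal) $(n+1)$-covers of $L$, then $$p \leq \frac{2q+n(n-4)t}{3n-6}.$$
   Context: A Latin square of order $n$ is an $n\times n$ array on $n$ symbols in which each symbol occurs once in each row and each column; its set of entries is $E(L)=\{(i,j,L_{ij})\}$. A line is the set of all entries in a given row, in a given column, or with a given symbol. A cover is a subset of $E(L)$ meeting every line; an $(n+1)$-cover is a cover of size $n+1$; a cover $\mathscr{C}$ is minimal if $\mathscr{C}\setminus\{\mathbf{e}\}$ is not a cover for all $\mathbf{e}\in\mathscr{C}$. A partial transversal of deficit $d$ is an $(n-d)$-subset of $E(L)$ in which every line is represented at most once; a transversal is one of deficit $0$; a partial transversal is maximal if adding any further entry destroys this property. The Latin square graph $\Gamma_L$ has vertex set $E(L)$, two distinct entries adjacent when they share a row, a column or a symbol. For an $(n+1)$-cover $\mathscr{C}$, the subgraph of $\Gamma_L$ induced by $\mathscr{C}$ has exactly three edges; after deleting isolated vertices it is isomorphic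 to one of: $G_1$ = three disjoint edges ($3K_2$); $G_2$ = disjoint union of a path with 2 edges and a single edge ($P_3\cup K_2$); $G_3$ = a path with 3 edges ($P_4$); $G_4$ = the star $K_{1,3}$; $G_5$ = a triangle $K_3$. For $i\in\{1,\dots,5\}$, $q_i$ is the number of $(n+1)$-covers of $L$ whose induced graph (ignoring isolated vertices) is isomorphic to $G_i$. -}

module Defs where

open import Data.Nat using (ℕ; zero; suc; _+_; _*_; _∸_)
open import Data.Fin using (Fin; zero; suc; combine)
open import Data.Fin.Subset using (Subset; _∈_; _∉_; ⁅_⁆; _∪_; _─_; ∣_∣; inside; outside)
open import Data.List using (List; []; _∷_; _++_; map)
open import Data.List.Membership.Propositional using () renaming (_∈_ to _∈ₗ_)
open import Data.Vec using (_∷_; [])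
open import Data.Product using (Σ; ∃; ∃-syntax; _×_; _,_)
open import Data.Sum using (_⊎_)
open import Relation.Binary.PropositionalEquality using (_≡_; _≢_)
open import Relation.Nullary using (¬_)

record LatinSquare (n : ℕ) : Set where
  field
    sym     : Fin n → Fin n → Fin n
    rowHas  : ∀ i s → ∃[ j ] sym i j ≡ s
    rowOnce : ∀ i j j′ → sym i j ≡ sym i j′ → j ≡ j′
    colHas  : ∀ j s → ∃[ i ] sym i j ≡ s
    colOnce : ∀ j i i′ → sym i j ≡ sym i′ j → i ≡ i′
open LatinSquare public

-- An entry (i , j , L i j) of E(L) is determined by its cell (i , j).
Cell : ℕ → Set
Cell n = Fin n × Fin n

-- Subsets of E(L) are represented as subsets of the n*n cells,
-- the cell (i , j) being encoded as  combine i j : Fin (n * n).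
Sub : ℕ → Set
Sub n = Subset (n * n)

infix 4 _∈E_ _∉E_
_∈E_ : ∀ {n} → Cell n → Sub n → Set
(i , j) ∈E S = combine i j ∈ S

_∉E_ : ∀ {n} → Cell n → Sub n → Set
(i , j) ∉E S = combine i j ∉ S

removeE : ∀ {n} → Sub n → Cell n → Sub n
removeE S (i , j) = S ─ ⁅ combine i j ⁆

addE : ∀ {n} → Sub n → Cell n → Sub n
addE S (i , j) = S ∪ ⁅ combine i j ⁆

data Line (n : ℕ) : Set where
  row col symb : Fin n → Line n

OnLine : ∀ {n} → LatinSquare n → Line n → Cell n → Set
OnLine L (row r)  (i , j) = i ≡ r
OnLine L (col c)  (i , j) = j ≡ c
OnLine L (symb s) (i , j) = sym L i j ≡ s

Cover : ∀ {n} → LatinSquare n → Sub n → Set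
Cover L S = ∀ ℓ → ∃[ e ] (e ∈E S × OnLine L ℓ e)

NCover : ∀ {n} → LatinSquare n → Sub n → Set
NCover {n} L S = Cover L S × ∣ S ∣ ≡ suc n

MinimalCover : ∀ {n} → LatinSquare n → Sub n → Set
MinimalCover {n} L S = Cover L S × (∀ (e : Cell n) → _∈E_ {n} e S → ¬ Cover L (removeE {n} S e))

MinNCover : ∀ {n} → LatinSquare n → Sub n → Set
MinNCover L S = NCover L S × MinimalCover L S

AtMostOnce : ∀ {n} → LatinSquare n → Sub n → Set
AtMostOnce L S = ∀ ℓ e e′ → e ∈E S → e′ ∈E S → OnLine L ℓ e → OnLine L ℓ e′ → e ≡ e′

PartialTransversal : ∀ {n} → LatinSquare n → ℕ → Sub n → Set
PartialTransversal {n} L d S = ∣ S ∣ ≡ n ∸ d × AtMostOnce L S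

Transversal : ∀ {n} → LatinSquare n → Sub n → Set
Transversal L = PartialTransversal L 0

MaximalPT : ∀ {n} → LatinSquare n → ℕ → Sub n → Set
MaximalPT {n} L d S = PartialTransversal L d S × (∀ (e : Cell n) → e ∉E S → ¬ AtMostOnce L (addE {n} S e))

Adj : ∀ {n} → LatinSquare n → Cell n → Cell n → Set
Adj L (i , j) (i′ , j′) =
  (i , j) ≢ (i′ , j′) × (i ≡ i′ ⊎ j ≡ j′ ⊎ sym L i j ≡ sym L i′ j′)

record SmallGraph : Set where
  field
    size  : ℕ
    edges : List (Fin size × Fin size)
open SmallGraph public

GEdge : (G : SmallGraph) → Fin (size G) → Fin (size G) → Set
GEdge G u v = (u , v) ∈ₗ edges G ⊎ (v , u) ∈ₗ edges G

-- The subgraph of Γ_L induced by S, with isolated vertices deleted, is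
-- isomorphic to G (G having no isolated vertices): there is an injective
-- map f from V(G) into S, preserving and reflecting adjacency, whose image
-- contains every non-isolated vertex of the induced subgraph.
InducedIso : ∀ {n} → LatinSquare n → SmallGraph → Sub n → Set
InducedIso {n} L G S =
  Σ (Fin (size G) → Cell n) λ f →
    (∀ u v → f u ≡ f v → u ≡ v) ×
    (∀ u → f u ∈E S) ×
    (∀ u v → (Adj L (f u) (f v) → GEdge G u v) × (GEdge G u v → Adj L (f u) (f v))) ×
    (∀ x y → x ∈E S → y ∈E S → Adj L x y → ∃[ u ] f u ≡ x)

v : ∀ {m} (k : ℕ) → Fin (suc k + m)
v zero    = zero
v (suc k) = suc (v k)

G₁ : SmallGraph
G₁ = record { size = 6 ; edges = ((v 0) , (v 1)) ∷ ((v 2) , (v 3)) ∷ ((v 4) , (v 5)) ∷ [] }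

G₂ : SmallGraph
G₂ = record { size = 5 ; edges = ((v 0) , (v 1)) ∷ ((v 1) , (v 2)) ∷ ((v 3) , (v 4)) ∷ [] }

G₃ : SmallGraph
G₃ = record { size = 4 ; edges = ((v 0) , (v 1)) ∷ ((v 1) , (v 2)) ∷ ((v 2) , (v 3)) ∷ [] }

G₄ : SmallGraph
G₄ = record { size = 4 ; edges = ((v 0) , (v 1)) ∷ ((v 0) , (v 2)) ∷ ((v 0) , (v 3)) ∷ [] }

G₅ : SmallGraph
G₅ = record { size = 3 ; edges = ((v 0) , (v 1)) ∷ ((v 1) , (v 2)) ∷ ((v 0) , (v 2)) ∷ [] }

CoverOfType : ∀ {n} → LatinSquare n → SmallGraph → Sub n → Set
CoverOfType L G S = NCover L S × InducedIso L G S

allSubsets : (m : ℕ) → List (Subset m)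
allSubsets zero    = [] ∷ []
allSubsets (suc m) = map (outside ∷_) (allSubsets m) ++ map (inside ∷_) (allSubsets m)

data CountIn {A : Set} (P : A → Set) : List A → ℕ → Set where
  c[]   : CountIn P [] 0
  cyes  : ∀ {x xs k} → P x → CountIn P xs k → CountIn P (x ∷ xs) (suc k)
  cno   : ∀ {x xs k} → ¬ P x → CountIn P xs k → CountIn P (x ∷ xs) k

NumberOf : (n : ℕ) → (Sub n → Set) → ℕ → Set
NumberOf n P k = CountIn P (allSubsets (n * n)) k

{-# OPTIONS --safe #-}
-- An (n+1)-cover S has exactly one doubled row, column and symbol; the pairs on
-- these three lines are the edges of its graph. S is minimal unless some entry
-- lies on all three doubled lines, which is type G₄. A partial transversal T of
-- deficit 1 misses one row, one column and one symbol. T ∪ {x, y} is a minimal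
-- cover with T maximal iff x and y together hit the three missing lines of T,
-- or equivalently the three doubled lines of the cover. Both conditions are
-- about a pair hitting three sets with no common point. Counting such ordered
-- pairs, with weight 1 + [x ~ y] and with weight [x ~ y], over the T and over
-- the covers gives
--     6 n pmax = 4 q₂ + 8 q₃ + 12 q₅   and   6 pmax = 2 q₃ + 6 q₅,
-- which imply the bounds on pmax. For the last inequality, a non-maximal T
-- extends to a transversal, so p ≤ pmax + n t, and a transversal plus an entry is
-- a non-minimal (n+1)-cover determining that entry, so qmin + (n² - n) t ≤ q.
module Submission where

open import Defs renaming (sym to entry; v to vertex)
open import Data.Nat using (ℕ; zero; suc; _+_; _*_; _∸_; _≤_; _<_; z≤n; s≤s)
open import Data.Nat.Properties hiding (_≟_)
open import Algebra.Properties.CommutativeSemigroup *-commutativeSemigroup using (x∙yz≈y∙xz)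
open import Data.Nat.Tactic.RingSolver using (solve-∀)
import Data.Bool as Bool
import Data.Nat as ℕ
open import Data.Bool using (Bool; true; false; _∧_; _∨_; not)
import Data.Empty as Empty
open import Data.Fin using (Fin; zero; suc; combine; remQuot; _≟_)
open import Data.Fin.Properties using (all?; any?; injective⇒≤; combine-injective; remQuot-combine; combine-remQuot)
open import Data.Fin.Subset using (Subset; inside; outside; ⁅_⁆; _∪_; _─_; _-_; _∉_; ∣_∣; ⊥)
open import Data.Fin.Subset.Properties using (_∈?_; ∪-identityʳ; p─⊥≡p; x∈p∪q⁺; x∈p∪q⁻; x∈⁅x⁆; x∈⁅y⁆⇒x≡y; x∈p∧x≢y⇒x∈p-y; p─q⊆p)
open import Data.List using (List; []; _∷_; _++_; map; allFin; tabulate; cartesianProduct)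
open import Data.List.Properties using (map-tabulate)
open import Data.List.Membership.Propositional using () renaming (_∈_ to _∈ₗ_)
open import Data.List.Membership.Propositional.Properties using (∈-allFin; ∈-cartesianProduct⁺; ∈-map⁺; ∈-++⁺ˡ; ∈-++⁺ʳ)
open import Data.List.Relation.Unary.Any using (here; there)
open import Data.List.Relation.Unary.All as All using (All; []; _∷_)
open import Data.List.Relation.Unary.AllPairs using ([]; _∷_)
open import Data.List.Relation.Unary.Unique.Propositional using (Unique)
import Data.List.Relation.Unary.Unique.Propositional.Properties as Unique
open import Data.List.Membership.DecPropositional using () renaming (_∈?_ to ∈?-via)
open import Data.Vec using (Vec; []; _∷_; there; lookup)
open import Data.Vec.Relation.Unary.All using ([]; _∷_)
open import Data.Vec.Relation.Unary.AllPairs using ([]; _∷_)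
open import Data.Vec.Relation.Unary.Unique.Propositional using () renaming (Unique to VecUnique)
open import Data.Vec.Relation.Unary.Unique.Propositional.Properties using (lookup-injective)
open import Data.Product using (∃; ∃-syntax; _×_; _,_; proj₁; proj₂; uncurry)
open import Data.Product.Properties using (≡-dec)
open import Data.Sum using (_⊎_; inj₁; inj₂; [_,_]′; swap; reduce)
open import Function using (_∘_; id)
open import Relation.Binary using (DecidableEquality)
open import Relation.Binary.PropositionalEquality hiding ([_])
open import Relation.Nullary using (¬_; Dec; yes; no; does; contradiction)
open import Relation.Nullary.Decidable using (_×-dec_; _⊎-dec_; ¬?; dec-true; dec-false; from-yes; decidable-stable; _→-dec_)

-- Let `R`, `C`, `S` be the sizes of the three sets and `α`, `β`, `γ` the numbers of points common
-- to two of them. The two weighted sums are then 2(Rγ + Cβ + Sα) and 2(αβ + αγ + βγ). The missing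
-- lines of T, taken as full lines of the square, have n cells each and cross pairwise in one cell,
-- which gives 6n and 6. The doubled lines of a minimal cover carry two of its entries each, and any
-- two share at most one, so only the number of crossings inside the cover matters: 0, 1, 2, 3 for
-- G₁, G₂, G₃, G₅. A cover of type G₁ has no hitting pair at all, which is why q₁ is subtracted in
-- the bounds. Eliminating gives 2(q₂ + q₃ + q₅) = 3n pmax - (2q₃ + 4q₅), and 6 pmax = 2q₃ + 6q₅
-- places 2q₃ + 4q₅ between 4 pmax and 6 pmax: hence the 4 and the 6 in the denominators.

variable
  A B : Set
  P Q : Set

-- Indicators and finite sums

𝟙 : Bool → ℕ
𝟙 true  = 1
𝟙 false = 0

𝟙-∧ : ∀ a b → 𝟙 (a ∧ b) ≡ 𝟙 a * 𝟙 b
𝟙-∧ true  b = sym (+-identityʳ (𝟙 b))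
𝟙-∧ false b = refl

ind : Dec P → ℕ
ind d = 𝟙 (does d)

ind-yes : (d : Dec P) → P → ind d ≡ 1
ind-yes d p = cong 𝟙 (dec-true d p)

ind-no : (d : Dec P) → ¬ P → ind d ≡ 0
ind-no d ¬p = cong 𝟙 (dec-false d ¬p)

ind-witness : ∀ {k} (d : Dec P) → ind d ≡ suc k → P
ind-witness (yes p) _ = p

ind-cong : (d : Dec P) (e : Dec Q) → (P → Q) → (Q → P) → ind d ≡ ind e
ind-cong (yes p) e f g = sym (ind-yes e (f p))
ind-cong (no ¬p) e f g = sym (ind-no e (¬p ∘ g))

ind-× : (d : Dec P) (e : Dec Q) → ind (d ×-dec e) ≡ ind d * ind e
ind-× d e = 𝟙-∧ (does d) (does e)

opaque
  ∑ₗ : List A → (A → ℕ) → ℕ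
  ∑ₗ []       f = 0
  ∑ₗ (x ∷ xs) f = f x + ∑ₗ xs f

  ∑-[] : ∀ {f : A → ℕ} → ∑ₗ [] f ≡ 0
  ∑-[] = refl

  ∑-∷ : ∀ (f : A → ℕ) x xs → ∑ₗ (x ∷ xs) f ≡ f x + ∑ₗ xs f
  ∑-∷ f x xs = refl

  ∑-cong : ∀ {f g : A → ℕ} xs → (∀ x → f x ≡ g x) → ∑ₗ xs f ≡ ∑ₗ xs g
  ∑-cong []       f≗g = refl
  ∑-cong (x ∷ xs) f≗g = cong₂ _+_ (f≗g x) (∑-cong xs f≗g)

  ∑-mono : ∀ {f g : A → ℕ} xs → (∀ x → f x ≤ g x) → ∑ₗ xs f ≤ ∑ₗ xs g
  ∑-mono []       f≤g = z≤n
  ∑-mono (x ∷ xs) f≤g = +-mono-≤ (f≤g x) (∑-mono xs f≤g)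

  ∑-0 : (xs : List A) → ∑ₗ xs (λ _ → 0) ≡ 0
  ∑-0 []       = refl
  ∑-0 (_ ∷ xs) = ∑-0 xs

  ∑-+ : ∀ (f g : A → ℕ) xs → ∑ₗ xs (λ x → f x + g x) ≡ ∑ₗ xs f + ∑ₗ xs g
  ∑-+ f g []       = refl
  ∑-+ f g (x ∷ xs) = trans (cong (f x + g x +_) (∑-+ f g xs))
    (interchange (f x) (g x) (∑ₗ xs f) (∑ₗ xs g))
    where
    interchange : ∀ a b c d → a + b + (c + d) ≡ a + c + (b + d)
    interchange = solve-∀

  ∑-*ʳ : ∀ (f : A → ℕ) c xs → ∑ₗ xs (λ x → f x * c) ≡ ∑ₗ xs f * c
  ∑-*ʳ f c []       = refl
  ∑-*ʳ f c (x ∷ xs) =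
    trans (cong (f x * c +_) (∑-*ʳ f c xs)) (sym (*-distribʳ-+ c (f x) _))

  ∑-*ˡ : ∀ c (f : A → ℕ) xs → ∑ₗ xs (λ x → c * f x) ≡ c * ∑ₗ xs f
  ∑-*ˡ c f []       = sym (*-zeroʳ c)
  ∑-*ˡ c f (x ∷ xs) =
    trans (cong (c * f x +_) (∑-*ˡ c f xs)) (sym (*-distribˡ-+ c (f x) _))

  ∑-swap : ∀ (f : A → B → ℕ) xs ys →
           ∑ₗ xs (λ x → ∑ₗ ys (f x)) ≡ ∑ₗ ys (λ y → ∑ₗ xs (λ x → f x y))
  ∑-swap f []       ys = sym (∑-0 ys)
  ∑-swap f (x ∷ xs) ys =
    trans (cong (∑ₗ ys (f x) +_) (∑-swap f xs ys)) (sym (∑-+ (f x) (λ y → ∑ₗ xs (λ x → f x y)) ys))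

  ∑-++ : ∀ (f : A → ℕ) xs ys → ∑ₗ (xs ++ ys) f ≡ ∑ₗ xs f + ∑ₗ ys f
  ∑-++ f []       ys = refl
  ∑-++ f (x ∷ xs) ys = trans (cong (f x +_) (∑-++ f xs ys)) (sym (+-assoc (f x) _ _))

  ∑-map : ∀ (f : B → ℕ) (g : A → B) xs → ∑ₗ (map g xs) f ≡ ∑ₗ xs (f ∘ g)
  ∑-map f g []       = refl
  ∑-map f g (x ∷ xs) = cong (f (g x) +_) (∑-map f g xs)

  ∑≡0⇒ : ∀ {f : A → ℕ} {xs x} → ∑ₗ xs f ≡ 0 → x ∈ₗ xs → f x ≡ 0
  ∑≡0⇒ {f = f} {x ∷ xs} eq (here refl) = m+n≡0⇒m≡0 (f x) eq
  ∑≡0⇒ {f = f} {x ∷ xs} eq (there x∈)  = ∑≡0⇒ {xs = xs} (m+n≡0⇒n≡0 (f x) eq) x∈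

  ∑≡suc⇒ : ∀ {f : A → ℕ} {xs k} → ∑ₗ xs f ≡ suc k → ∃[ x ] ∃[ j ] f x ≡ suc j
  ∑≡suc⇒ {f = f} {x ∷ xs} eq with f x in fx
  ... | zero  = ∑≡suc⇒ {xs = xs} eq
  ... | suc j = x , j , fx

  ∑-vanish : ∀ {f : A → ℕ} {xs} → All (λ x → f x ≡ 0) xs → ∑ₗ xs f ≡ 0
  ∑-vanish []         = refl
  ∑-vanish (p ∷ ps) = cong₂ _+_ p (∑-vanish ps)

  ∑-singleₗ : ∀ {f : A → ℕ} {xs x} → Unique xs → x ∈ₗ xs →
              (∀ y → y ≢ x → f y ≡ 0) → ∑ₗ xs f ≡ f x
  ∑-singleₗ {f = f} {x ∷ xs} (x∉ ∷ _) (here refl) off =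
    trans (cong (f x +_) (∑-vanish (All.map (λ x≢y → off _ (x≢y ∘ sym)) x∉))) (+-identityʳ (f x))
  ∑-singleₗ {f = f} {y ∷ xs} (y∉ ∷ u) (there x∈) off =
    cong₂ _+_ (off y (All.lookup y∉ x∈)) (∑-singleₗ u x∈ off)

record Finite (A : Set) : Set where
  field
    elems    : List A
    unique   : Unique elems
    complete : ∀ x → x ∈ₗ elems
    _==_     : DecidableEquality A

open Finite ⦃ ... ⦄ public

∑ : ⦃ _ : Finite A ⦄ → (A → ℕ) → ℕ
∑ f = ∑ₗ elems f

count : ⦃ _ : Finite A ⦄ {P : A → Set} → (∀ x → Dec (P x)) → ℕ
count P? = ∑ (ind ∘ P?)

allSubsets-complete : ∀ {m} (S : Subset m) → S ∈ₗ allSubsets m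
allSubsets-complete []            = here refl
allSubsets-complete (outside ∷ S) = ∈-++⁺ˡ (∈-map⁺ (outside ∷_) (allSubsets-complete S))
allSubsets-complete (inside  ∷ S) =
  ∈-++⁺ʳ (map (outside ∷_) (allSubsets _)) (∈-map⁺ (inside ∷_) (allSubsets-complete S))

instance
  finiteFin : ∀ {n} → Finite (Fin n)
  finiteFin {n} = record
    { elems = allFin n ; unique = Unique.allFin⁺ n ; complete = ∈-allFin ; _==_ = _≟_ }

  finite× : ⦃ _ : Finite A ⦄ ⦃ _ : Finite B ⦄ → Finite (A × B)
  finite× = record
    { elems    = cartesianProduct elems elems
    ; unique   = Unique.cartesianProduct⁺ unique unique
    ; complete = λ (x , y) → ∈-cartesianProduct⁺ (complete x) (complete y)
    ; _==_     = ≡-dec _==_ _==_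
    }

module _ ⦃ _ : Finite A ⦄ where

  ∑-single : ∀ {f : A → ℕ} x → (∀ y → y ≢ x → f y ≡ 0) → ∑ f ≡ f x
  ∑-single x = ∑-singleₗ unique (complete x)

  ∑-extract : ∀ (f : A → ℕ) x → ∑ f ≡ f x + ∑ (λ y → ind (¬? (y == x)) * f y)
  ∑-extract f x = begin
    ∑ f                                                              ≡⟨ ∑-cong _ split ⟩
    ∑ (λ y → ind (y == x) * f y + ind (¬? (y == x)) * f y)           ≡⟨ ∑-+ _ _ _ ⟩
    ∑ (λ y → ind (y == x) * f y) + ∑ (λ y → ind (¬? (y == x)) * f y) ≡⟨ cong (_+ rest) at ⟩
    f x + ∑ (λ y → ind (¬? (y == x)) * f y)                          ∎
    where
    open ≡-Reasoning
    rest = ∑ (λ y → ind (¬? (y == x)) * f y)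
    split : ∀ y → f y ≡ ind (y == x) * f y + ind (¬? (y == x)) * f y
    split y with does (y == x)
    ... | true  = sym (trans (+-identityʳ _) (*-identityˡ (f y)))
    ... | false = sym (*-identityˡ (f y))
    at : ∑ (λ y → ind (y == x) * f y) ≡ f x
    at = trans (∑-single x (λ y y≢x → cong (_* f y) (ind-no (y == x) y≢x)))
               (trans (cong (_* f x) (ind-yes (x == x) refl)) (*-identityˡ (f x)))

  ∑≡1⇒ : ∀ {f : A → ℕ} → ∑ f ≡ 1 → ∃[ x ] (f x ≡ 1 × (∀ y → y ≢ x → f y ≡ 0))
  ∑≡1⇒ {f} eq with ∑≡suc⇒ {xs = elems} eq
  ... | x , j , fx = x , trans fx (cong suc j≡0) , off
    where
    rest = ∑ (λ y → ind (¬? (y == x)) * f y)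
    j+rest≡0 : j + rest ≡ 0
    j+rest≡0 = suc-injective (trans (sym (trans (∑-extract _ x) (cong (_+ rest) fx))) eq)
    j≡0 = m+n≡0⇒m≡0 j j+rest≡0
    off : ∀ y → y ≢ x → f y ≡ 0
    off y y≢x = trans (sym (*-identityˡ (f y)))
      (trans (cong (_* f y) (sym (ind-yes (¬? (y == x)) y≢x)))
             (∑≡0⇒ {xs = elems} (m+n≡0⇒n≡0 j j+rest≡0) (complete y)))

-- Each term f x is spread out as the sum over y of [y = ψ x] f x; after the two sums are swapped,
-- only x = φ y survives for a given y.
∑-reindex : ⦃ _ : Finite A ⦄ ⦃ _ : Finite B ⦄ {f : A → ℕ} (φ : B → A) (ψ : A → B) →
            (∀ x → φ (ψ x) ≡ x) → (∀ y → ψ (φ y) ≡ y) → ∑ f ≡ ∑ (f ∘ φ)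
∑-reindex {f = f} φ ψ φψ ψφ = begin
  ∑ f                                          ≡⟨ ∑-cong _ (λ x → sym (spread x)) ⟩
  ∑ (λ x → ∑ (λ y → ind (y == ψ x) * f x))     ≡⟨ ∑-swap _ _ _ ⟩
  ∑ (λ y → ∑ (λ x → ind (y == ψ x) * f x))     ≡⟨ ∑-cong _ collapse ⟩
  ∑ (f ∘ φ)                                    ∎
  where
  open ≡-Reasoning
  spread : ∀ x → ∑ (λ y → ind (y == ψ x) * f x) ≡ f x
  spread x = trans (∑-single (ψ x) (λ y y≢ → cong (_* f x) (ind-no (y == ψ x) y≢)))
    (trans (cong (_* f x) (ind-yes (ψ x == ψ x) refl)) (*-identityˡ (f x)))
  collapse : ∀ y → ∑ (λ x → ind (y == ψ x) * f x) ≡ f (φ y)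
  collapse y = trans
    (∑-single (φ y) (λ x x≢ → cong (_* f x)
      (ind-no (y == ψ x) (λ y≡ → x≢ (trans (sym (φψ x)) (cong φ (sym y≡)))))))
    (trans (cong (_* f (φ y)) (ind-yes (y == ψ (φ y)) (sym (ψφ y)))) (*-identityˡ (f (φ y))))

module _ ⦃ _ : Finite A ⦄ {P : A → Set} (P? : ∀ x → Dec (P x)) where

  private
    other? : ∀ x y → Dec (y ≢ x × P y)
    other? x y = ¬? (y == x) ×-dec P? y

  count-witness : ∀ {k} → count P? ≡ suc k → ∃ P
  count-witness eq with ∑≡suc⇒ {xs = elems} eq
  ... | x , _ , px = x , ind-witness (P? x) px

  count-empty : count P? ≡ 0 → ∀ x → ¬ P x
  count-empty eq x p with trans (sym (ind-yes (P? x) p)) (∑≡0⇒ {xs = elems} eq (complete x))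
  ... | ()

  count-none : (∀ x → ¬ P x) → count P? ≡ 0
  count-none ¬P = trans (∑-cong _ (λ x → ind-no (P? x) (¬P x))) (∑-0 _)

  count-extract : ∀ {x} → P x → count P? ≡ suc (count (other? x))
  count-extract {x} p = trans (∑-extract _ x)
    (cong₂ _+_ (ind-yes (P? x) p) (∑-cong _ (λ y → sym (ind-× (¬? (y == x)) (P? y)))))

count-cong : ⦃ _ : Finite A ⦄ {P Q : A → Set} (P? : ∀ x → Dec (P x)) (Q? : ∀ x → Dec (Q x)) →
             (∀ {x} → P x → Q x) → (∀ {x} → Q x → P x) → count P? ≡ count Q?
count-cong P? Q? f g = ∑-cong _ (λ x → ind-cong (P? x) (Q? x) f g)

module _ ⦃ _ : Finite A ⦄ {P : A → Set} (P? : ∀ x → Dec (P x)) where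

  count≡1⇒unique : count P? ≡ 1 → ∀ {x y} → P x → P y → y ≡ x
  count≡1⇒unique eq {x} {y} px py with y == x
  ... | yes y≡x = y≡x
  ... | no  y≢x = contradiction (y≢x , py)
    (count-empty (λ w → ¬? (w == x) ×-dec P? w) (suc-injective (trans (sym (count-extract P? px)) eq)) y)

module _ ⦃ _ : Finite A ⦄ {P : A → Set} (P? : ∀ x → Dec (P x)) where

  count-≤1 : (∀ {x y} → P x → P y → y ≡ x) → count P? ≤ 1
  count-≤1 u with count P? in eq
  ... | zero  = z≤n
  ... | suc k with count-witness P? eq
  ... | x , px = ≤-reflexive (trans (sym eq) (trans (count-extract P? px)
    (cong suc (count-none (λ y → ¬? (y == x) ×-dec P? y) λ y (y≢x , py) → y≢x (u px py)))))

  count-≥1 : ∀ {x} → P x → 1 ≤ count P?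
  count-≥1 px = subst (1 ≤_) (sym (count-extract P? px)) (s≤s z≤n)

  count≡1 : (∀ {x y} → P x → P y → y ≡ x) → ∃ P → count P? ≡ 1
  count≡1 u (x , px) = ≤-antisym (count-≤1 u) (count-≥1 px)

  count≡2⇒pair : count P? ≡ 2 → ∀ {x} → P x →
                 ∃[ y ] (y ≢ x × P y × (∀ {z} → P z → z ≡ x ⊎ z ≡ y))
  count≡2⇒pair eq {x} px = pair
    where
    other≡1 = suc-injective (trans (sym (count-extract P? px)) eq)
    pair : ∃[ y ] (y ≢ x × P y × (∀ {z} → P z → z ≡ x ⊎ z ≡ y))
    pair with count-witness (λ w → ¬? (w == x) ×-dec P? w) other≡1
    ... | y , y≢x , py = y , y≢x , py , only
      where
      only : ∀ {z} → P z → z ≡ x ⊎ z ≡ y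
      only {z} pz with z == x
      ... | yes z≡x = inj₁ z≡x
      ... | no  z≢x = inj₂ (count≡1⇒unique (λ w → ¬? (w == x) ×-dec P? w) other≡1 (y≢x , py) (z≢x , pz))

  count-≥2 : ∀ {x y} → P x → P y → y ≢ x → 2 ≤ count P?
  count-≥2 {x} {y} px py y≢x = subst (2 ≤_) (sym (count-extract P? px))
    (s≤s (≤-trans (s≤s z≤n) (≤-reflexive (sym (count-extract (λ w → ¬? (w == x) ×-dec P? w) (y≢x , py))))))

-- Sums over subsets

∑-suc : ∀ {m} (f : Fin (suc m) → ℕ) → ∑ f ≡ f zero + ∑ (f ∘ suc)
∑-suc {m} f = trans (∑-∷ f zero (tabulate suc)) (cong (f zero +_)
  (trans (cong (λ us → ∑ₗ us f) (sym (map-tabulate id suc))) (∑-map f suc (allFin m))))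

∑-allSubsets : ∀ {m} (f : Subset (suc m) → ℕ) → ∑ₗ (allSubsets (suc m)) f ≡
               ∑ₗ (allSubsets m) (f ∘ (outside ∷_)) + ∑ₗ (allSubsets m) (f ∘ (inside ∷_))
∑-allSubsets {m} f = trans (∑-++ f (map (outside ∷_) Ss) (map (inside ∷_) Ss))
  (cong₂ _+_ (∑-map f (outside ∷_) Ss) (∑-map f (inside ∷_) Ss))
  where Ss = allSubsets m

-- Deleting u is a bijection from the subsets containing u to those avoiding it. `F` takes both the
-- larger and the smaller set, so that either side can refer to the two at once.
∑-toggle : ∀ {m} (u : Fin m) (F : Subset m → Subset m → ℕ) →
  ∑ₗ (allSubsets m) (λ S → ind (u ∈? S) * F S (S ─ ⁅ u ⁆)) ≡
  ∑ₗ (allSubsets m) (λ T → ind (¬? (u ∈? T)) * F (T ∪ ⁅ u ⁆) T)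
∑-toggle {suc m} zero F = begin
  ∑ₗ (allSubsets (suc m)) _
    ≡⟨ ∑-allSubsets _ ⟩
  ∑ₗ Ss (λ _ → 0) + ∑ₗ Ss (λ S → 1 * F (inside ∷ S) (outside ∷ (S ─ ⊥)))
    ≡⟨ cong₂ _+_ (∑-0 Ss) (∑-cong Ss λ S → cong (1 *_) (cong₂ F
         (cong (inside ∷_) (sym (∪-identityʳ S))) (cong (outside ∷_) (p─⊥≡p S)))) ⟩
  ∑ₗ Ss (λ S → 1 * F (inside ∷ (S ∪ ⊥)) (outside ∷ S))
    ≡⟨ +-identityʳ _ ⟨
  ∑ₗ Ss (λ S → 1 * F (inside ∷ (S ∪ ⊥)) (outside ∷ S)) + 0
    ≡⟨ cong (∑ₗ Ss (λ S → 1 * F (inside ∷ (S ∪ ⊥)) (outside ∷ S)) +_) (∑-0 Ss) ⟨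
  ∑ₗ Ss (λ S → 1 * F (inside ∷ (S ∪ ⊥)) (outside ∷ S)) + ∑ₗ Ss (λ _ → 0)
    ≡⟨ ∑-allSubsets _ ⟨
  ∑ₗ (allSubsets (suc m)) _ ∎
  where
  open ≡-Reasoning
  Ss = allSubsets m
∑-toggle {suc m} (suc u) F = begin
  ∑ₗ (allSubsets (suc m)) _
    ≡⟨ ∑-allSubsets _ ⟩
  _ ≡⟨ cong₂ _+_ (∑-toggle u (λ S T → F (outside ∷ S) (outside ∷ T)))
                 (∑-toggle u (λ S T → F (inside ∷ S) (inside ∷ T))) ⟩
  _ ≡⟨ ∑-allSubsets _ ⟨
  ∑ₗ (allSubsets (suc m)) _ ∎
  where open ≡-Reasoning

x∉p-x : ∀ {m} (x : Fin m) (p : Subset m) → x ∉ p - x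
x∉p-x zero    (_ ∷ _) ()
x∉p-x (suc x) (_ ∷ p) (there x∈) = x∉p-x x p x∈

∣∣≡count : ∀ {m} (S : Subset m) → ∣ S ∣ ≡ count (_∈? S)
∣∣≡count []            = sym ∑-[]
∣∣≡count (outside ∷ S) = trans (∣∣≡count S) (sym (∑-suc _))
∣∣≡count (inside  ∷ S) = trans (cong suc (∣∣≡count S)) (sym (∑-suc _))

-- A counting derivation holds a proof or a refutation for each listed element. As every subset is
-- listed, the hypotheses of the theorem themselves decide predicates such as `MaximalPT` and
-- `InducedIso`.
countIn-decides : ∀ {P : A → Set} {xs k x} → CountIn P xs k → x ∈ₗ xs → Dec (P x)
countIn-decides (cyes p _) (here refl) = yes p
countIn-decides (cno ¬p _) (here refl) = no ¬p
countIn-decides (cyes _ c) (there x∈)  = countIn-decides c x∈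
countIn-decides (cno _ c)  (there x∈)  = countIn-decides c x∈

countIn-∑ : ∀ {P : A → Set} {xs k} (P? : ∀ x → Dec (P x)) → CountIn P xs k →
            k ≡ ∑ₗ xs (ind ∘ P?)
countIn-∑ P? c[]        = sym ∑-[]
countIn-∑ {xs = x ∷ xs} P? (cyes p c) = trans (cong₂ _+_ (sym (ind-yes (P? x) p)) (countIn-∑ P? c)) (sym (∑-∷ _ x xs))
countIn-∑ {xs = x ∷ xs} P? (cno ¬p c) = trans (cong₂ _+_ (sym (ind-no (P? x) ¬p)) (countIn-∑ P? c)) (sym (∑-∷ _ x xs))

private
  variable
    n : ℕ

∑Sub : (Sub n → ℕ) → ℕ
∑Sub {n} = ∑ₗ (allSubsets (n * n))

number-decides : ∀ {P : Sub n → Set} {k} → NumberOf n P k → ∀ S → Dec (P S)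
number-decides c S = countIn-decides c (allSubsets-complete S)

number-∑ : ∀ {P : Sub n → Set} {k} (c : NumberOf n P k) → k ≡ ∑Sub {n} (λ S → ind (number-decides {n} c S))
number-∑ {n} c = countIn-∑ (number-decides {n} c) c

infix 4 _∈E?_
_∈E?_ : (e : Cell n) (S : Sub n) → Dec (e ∈E S)
(i , j) ∈E? S = combine i j ∈? S

-- Adding and removing entries

module _ {n : ℕ} where

  code : Cell n → Fin (n * n)
  code = uncurry combine

  code-injective : ∀ {x y : Cell n} → code x ≡ code y → x ≡ y
  code-injective {i , j} {k , l} eq = uncurry (cong₂ _,_) (combine-injective i j k l eq)

  size≡count : (S : Sub n) → ∣ S ∣ ≡ count (λ (e : Cell n) → e ∈E? S)
  size≡count S = trans (∣∣≡count S)
    (∑-reindex code (remQuot n) (combine-remQuot {n} n) (λ (i , j) → remQuot-combine i j))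

  ∈-add⁺ : ∀ (T : Sub n) (e x : Cell n) → x ∈E T → x ∈E addE T e
  ∈-add⁺ T e x x∈ = x∈p∪q⁺ (inj₁ x∈)

  ∈-add-self : ∀ (T : Sub n) (e : Cell n) → e ∈E addE T e
  ∈-add-self T e = x∈p∪q⁺ {p = T} (inj₂ (x∈⁅x⁆ (code e)))

  ∈-add⁻ : ∀ (T : Sub n) (e x : Cell n) → x ∈E addE T e → x ∈E T ⊎ x ≡ e
  ∈-add⁻ T e x x∈ with x∈p∪q⁻ T ⁅ code e ⁆ x∈
  ... | inj₁ x∈T = inj₁ x∈T
  ... | inj₂ x∈e = inj₂ (code-injective (x∈⁅y⁆⇒x≡y (code e) x∈e))

  ∈-remove⁺ : ∀ (S : Sub n) (e x : Cell n) → x ∈E S → x ≢ e → x ∈E removeE S e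
  ∈-remove⁺ S e x x∈ x≢e = x∈p∧x≢y⇒x∈p-y x∈ (x≢e ∘ code-injective)

  ∈-remove⁻ : ∀ (S : Sub n) (e x : Cell n) → x ∈E removeE S e → x ∈E S × x ≢ e
  ∈-remove⁻ S e x x∈ = p─q⊆p S ⁅ code e ⁆ x∈ ,
    λ { refl → x∉p-x (code e) S x∈ }

  ∈-remove-or-≡ : ∀ (S : Sub n) (e x : Cell n) → x ∈E S → x ∈E removeE S e ⊎ x ≡ e
  ∈-remove-or-≡ S e x x∈ = by (x == e)
    where
    by : Dec (x ≡ e) → x ∈E removeE S e ⊎ x ≡ e
    by (yes x≡e) = inj₂ x≡e
    by (no  x≢e) = inj₁ (∈-remove⁺ S e x x∈ x≢e)

  ∈-add₂⁻ : ∀ (T : Sub n) (e₁ e₂ x : Cell n) → x ∈E addE (addE T e₂) e₁ →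
            x ∈E T ⊎ x ≡ e₁ ⊎ x ≡ e₂
  ∈-add₂⁻ T e₁ e₂ x x∈ =
    [ (λ x∈₂ → [ inj₁ , inj₂ ∘ inj₂ ]′ (∈-add⁻ T e₂ x x∈₂)) , inj₂ ∘ inj₁ ]′
      (∈-add⁻ (addE T e₂) e₁ x x∈)

  ∈-remove₂⁻ : ∀ (S : Sub n) (e₁ e₂ x : Cell n) → x ∈E removeE (removeE S e₁) e₂ →
               x ∈E S × x ≢ e₁ × x ≢ e₂
  ∈-remove₂⁻ S e₁ e₂ x x∈ =
    let x∈₁ , x≢e₂ = ∈-remove⁻ (removeE S e₁) e₂ x x∈
        x∈S , x≢e₁ = ∈-remove⁻ S e₁ x x∈₁
    in x∈S , x≢e₁ , x≢e₂

  ∈-remove₂-or-≡ : ∀ (S : Sub n) (e₁ e₂ x : Cell n) → x ∈E S →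
                   x ∈E removeE (removeE S e₁) e₂ ⊎ x ≡ e₁ ⊎ x ≡ e₂
  ∈-remove₂-or-≡ S e₁ e₂ x x∈ =
    [ (λ x∈₁ → [ inj₁ , inj₂ ∘ inj₂ ]′ (∈-remove-or-≡ (removeE S e₁) e₂ x x∈₁)) , inj₂ ∘ inj₁ ]′
      (∈-remove-or-≡ S e₁ x x∈)

  size-add : ∀ (T : Sub n) (e : Cell n) → e ∉E T → ∣ addE T e ∣ ≡ suc ∣ T ∣
  size-add T e e∉ = begin
    ∣ addE T e ∣                                      ≡⟨ size≡count (addE T e) ⟩
    count (_∈E? addE T e)                             ≡⟨ count-extract (_∈E? addE T e) (∈-add-self T e) ⟩
    suc (count λ x → ¬? (x == e) ×-dec (x ∈E? addE T e)) ≡⟨ cong suc (count-cong (λ x → ¬? (x == e) ×-dec (x ∈E? addE T e)) (_∈E? T) to from) ⟩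
    suc (count (_∈E? T))                              ≡⟨ cong suc (size≡count T) ⟨
    suc ∣ T ∣                                         ∎
    where
    open ≡-Reasoning
    to : ∀ {x} → x ≢ e × x ∈E addE T e → x ∈E T
    to (x≢e , x∈) = [ id , (λ x≡e → contradiction x≡e x≢e) ]′ (∈-add⁻ T e _ x∈)
    from : ∀ {x} → x ∈E T → x ≢ e × x ∈E addE T e
    from x∈ = (λ { refl → e∉ x∈ }) , ∈-add⁺ T e _ x∈

  size-remove : ∀ (S : Sub n) (e : Cell n) → e ∈E S → ∣ S ∣ ≡ suc ∣ removeE S e ∣
  size-remove S e e∈ = begin
    ∣ S ∣                                      ≡⟨ size≡count S ⟩
    count (_∈E? S)                             ≡⟨ count-extract (_∈E? S) e∈ ⟩
    suc (count λ x → ¬? (x == e) ×-dec (x ∈E? S)) ≡⟨ cong suc (count-cong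
      (λ x → ¬? (x == e) ×-dec (x ∈E? S)) (_∈E? removeE S e)
      (λ (x≢e , x∈) → ∈-remove⁺ S e _ x∈ x≢e)
      (λ x∈ → let y = ∈-remove⁻ S e _ x∈ in proj₂ y , proj₁ y)) ⟩
    suc (count (_∈E? removeE S e))             ≡⟨ cong suc (size≡count (removeE S e)) ⟨
    suc ∣ removeE S e ∣                        ∎
    where open ≡-Reasoning

  -- Pairs of a set and an entry in it are matched with pairs of a set and a cell outside it. Every
  -- double count below rests on one or two such exchanges.
  ∑∑-toggle : (F : Cell n → Sub n → Sub n → ℕ) →
    ∑Sub {n} (λ S → ∑ λ e → ind (e ∈E? S) * F e S (removeE S e)) ≡
    ∑Sub {n} (λ T → ∑ λ e → ind (¬? (e ∈E? T)) * F e (addE T e) T)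
  ∑∑-toggle F = trans (∑-swap _ _ _) (trans (∑-cong _ (λ e → ∑-toggle (code e) (F e))) (∑-swap _ _ _))

-- Pigeonhole for line counts

∑≡0⇒vanish : ∀ {f : Fin n → ℕ} → ∑ f ≡ 0 → ∀ x → f x ≡ 0
∑≡0⇒vanish eq x = ∑≡0⇒ eq (complete x)

∑-1 : ∑ {Fin n} (λ _ → 1) ≡ n
∑-1 {zero}  = ∑-[]
∑-1 {suc n} = trans (∑-suc _) (cong suc (∑-1 {n}))

module _ (c : Fin n → ℕ) where

  private
    -- Since c ℓ ≥ 1, the truncated c ℓ ∸ 1 is exact and the excesses add up to the total minus n. A
    -- total of n + 1 thus leaves a single line with excess 1.
    excess : (∀ ℓ → 1 ≤ c ℓ) → n + ∑ (λ ℓ → c ℓ ∸ 1) ≡ ∑ c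
    excess c≥1 = trans (cong (_+ ∑ (λ ℓ → c ℓ ∸ 1)) (sym (∑-1 {n})))
      (trans (sym (∑-+ _ _ _)) (∑-cong _ (λ ℓ → m+[n∸m]≡n (c≥1 ℓ))))

    defect : (∀ ℓ → c ℓ ≤ 1) → ∑ c + ∑ (λ ℓ → 1 ∸ c ℓ) ≡ n
    defect c≤1 = trans (sym (∑-+ _ _ _))
      (trans (∑-cong _ (λ ℓ → m+[n∸m]≡n (c≤1 ℓ))) (∑-1 {n}))

  no-excess : (∀ ℓ → 1 ≤ c ℓ) → ∑ c ≡ n → ∀ ℓ → c ℓ ≡ 1
  no-excess c≥1 eq ℓ = ≤-antisym (m∸n≡0⇒m≤n (∑≡0⇒vanish ∑≡0 ℓ)) (c≥1 ℓ)
    where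
    ∑≡0 : ∑ (λ ℓ → c ℓ ∸ 1) ≡ 0
    ∑≡0 = +-cancelˡ-≡ n _ _ (trans (excess c≥1) (trans eq (sym (+-identityʳ n))))

  no-defect : (∀ ℓ → c ℓ ≤ 1) → ∑ c ≡ n → ∀ ℓ → c ℓ ≡ 1
  no-defect c≤1 eq ℓ = ≤-antisym (c≤1 ℓ) (m∸n≡0⇒m≤n (∑≡0⇒vanish ∑≡0 ℓ))
    where
    ∑≡0 : ∑ (λ ℓ → 1 ∸ c ℓ) ≡ 0
    ∑≡0 = +-cancelˡ-≡ n _ _ (trans (cong (_+ ∑ (λ ℓ → 1 ∸ c ℓ)) (sym eq)) (trans (defect c≤1) (sym (+-identityʳ n))))

  single-excess : (∀ ℓ → 1 ≤ c ℓ) → ∑ c ≡ suc n → ∃[ d ] (c d ≡ 2 × (∀ ℓ → ℓ ≢ d → c ℓ ≡ 1))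
  single-excess c≥1 eq with ∑≡1⇒ {f = λ ℓ → c ℓ ∸ 1}
    (+-cancelˡ-≡ n _ _ (trans (excess c≥1) (trans eq (+-comm 1 n))))
  ... | d , at , off = d , trans (sym (m+[n∸m]≡n (c≥1 d))) (cong suc at)
      , λ ℓ ℓ≢d → ≤-antisym (m∸n≡0⇒m≤n (off ℓ ℓ≢d)) (c≥1 ℓ)

  single-defect : (∀ ℓ → c ℓ ≤ 1) → suc (∑ c) ≡ n → ∃[ d ] (c d ≡ 0 × (∀ ℓ → ℓ ≢ d → c ℓ ≡ 1))
  single-defect c≤1 eq with ∑≡1⇒ {f = λ ℓ → 1 ∸ c ℓ}
    (+-cancelˡ-≡ (∑ c) _ _ (trans (defect c≤1) (trans (sym eq) (+-comm 1 (∑ c)))))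
  ... | d , at , off = d
      , +-cancelʳ-≡ 1 _ _ (trans (cong (c d +_) (sym at)) (m+[n∸m]≡n (c≤1 d)))
      , λ ℓ ℓ≢d → ≤-antisym (c≤1 ℓ) (m∸n≡0⇒m≤n (off ℓ ℓ≢d))

-- Pairs hitting three sets

allBool? : ∀ {P : Bool → Set} → (∀ b → Dec (P b)) → Dec (∀ b → P b)
allBool? P? with P? true | P? false
... | yes p | yes q = yes λ { true → p ; false → q }
... | no ¬p | _     = no λ f → ¬p (f true)
... | _     | no ¬q = no λ f → ¬q (f false)

hits meets : (r c s r′ c′ s′ : Bool) → Bool
hits  r c s r′ c′ s′ = (r ∨ r′) ∧ (c ∨ c′) ∧ (s ∨ s′)
meets r c s r′ c′ s′ = (r ∧ r′) ∨ (c ∧ c′) ∨ (s ∧ s′)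

-- The factor 1 + `meets` is a multiplicity. If x lies in sets a, b and y in b, c, the pair can be
-- read both as "x in a, y in b and c" and as "x in a and b, y in c"; a hitting pair sharing no set
-- has one reading. The second identity lists the ordered choices of two different two-set
-- intersections.
HitsSplit : (r c s r′ c′ s′ : Bool) → Set
HitsSplit r c s r′ c′ s′ = (r ∧ c ∧ s) ≡ false → (r′ ∧ c′ ∧ s′) ≡ false →
  let h = hits r c s r′ c′ s′ ; m = meets r c s r′ c′ s′ in
  𝟙 h * suc (𝟙 m) ≡
    𝟙 r * 𝟙 (c′ ∧ s′) + 𝟙 c * 𝟙 (r′ ∧ s′) + 𝟙 s * 𝟙 (r′ ∧ c′) +
    (𝟙 (r ∧ c) * 𝟙 s′ + 𝟙 (r ∧ s) * 𝟙 c′ + 𝟙 (c ∧ s) * 𝟙 r′)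
  × 𝟙 h * 𝟙 m ≡
    𝟙 (r ∧ c) * 𝟙 (r′ ∧ s′) + 𝟙 (r ∧ c) * 𝟙 (c′ ∧ s′) + 𝟙 (r ∧ s) * 𝟙 (r′ ∧ c′) +
    (𝟙 (r ∧ s) * 𝟙 (c′ ∧ s′) + 𝟙 (c ∧ s) * 𝟙 (r′ ∧ c′) + 𝟙 (c ∧ s) * 𝟙 (r′ ∧ s′))

-- A pair hitting three sets without common point has a member in two of them,
-- so hitting is a disjunction of conditions "x in two sets, y in the third" (or
-- conversely); hits and hits ∧ meets are thus sums of products.
hits-split : ∀ r c s r′ c′ s′ → HitsSplit r c s r′ c′ s′
hits-split = from-yes split?
  where
  split? : Dec (∀ r c s r′ c′ s′ → HitsSplit r c s r′ c′ s′)
  split? = allBool? λ r → allBool? λ c → allBool? λ s →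
    allBool? λ r′ → allBool? λ c′ → allBool? λ s′ →
    ((r ∧ c ∧ s) Bool.≟ false) →-dec ((r′ ∧ c′ ∧ s′) Bool.≟ false) →-dec
    ((_ ℕ.≟ _) ×-dec (_ ℕ.≟ _))

module _ ⦃ _ : Finite A ⦄ where

  ∑∑-+ : ∀ {f g : A → A → ℕ} {a b} → ∑ (λ x → ∑ (f x)) ≡ a → ∑ (λ x → ∑ (g x)) ≡ b →
         ∑ (λ x → ∑ λ y → f x y + g x y) ≡ a + b
  ∑∑-+ p q = trans (∑-cong _ (λ x → ∑-+ _ _ _)) (trans (∑-+ _ _ _) (cong₂ _+_ p q))

  ∑∑-* : ∀ (f g : A → ℕ) → ∑ (λ x → ∑ λ y → f x * g y) ≡ ∑ f * ∑ g
  ∑∑-* f g = trans (∑-cong _ (λ x → ∑-*ˡ (f x) g _)) (∑-*ʳ f (∑ g) _)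

  module HittingPairs (r c s : A → Bool) (no-triple : ∀ x → (r x ∧ c x ∧ s x) ≡ false) where

    R C S α β γ : ℕ
    R = ∑ (𝟙 ∘ r)
    C = ∑ (𝟙 ∘ c)
    S = ∑ (𝟙 ∘ s)
    α = ∑ λ x → 𝟙 (r x ∧ c x)
    β = ∑ λ x → 𝟙 (r x ∧ s x)
    γ = ∑ λ x → 𝟙 (c x ∧ s x)

    hit meet : A → A → ℕ
    hit  x y = 𝟙 (hits  (r x) (c x) (s x) (r y) (c y) (s y))
    meet x y = 𝟙 (meets (r x) (c x) (s x) (r y) (c y) (s y))

    ∑∑-hit-suc-meet : ∑ (λ x → ∑ λ y → hit x y * suc (meet x y)) ≡
                      R * γ + C * β + S * α + (α * S + β * C + γ * R)
    ∑∑-hit-suc-meet = trans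
      (∑-cong _ λ x → ∑-cong _ λ y →
        proj₁ (hits-split (r x) (c x) (s x) (r y) (c y) (s y) (no-triple x) (no-triple y)))
      (∑∑-+ (∑∑-+ (∑∑-+ (∑∑-* _ _) (∑∑-* _ _)) (∑∑-* _ _))
            (∑∑-+ (∑∑-+ (∑∑-* _ _) (∑∑-* _ _)) (∑∑-* _ _)))

    ∑∑-hit-meet : ∑ (λ x → ∑ λ y → hit x y * meet x y) ≡
                  α * β + α * γ + β * α + (β * γ + γ * α + γ * β)
    ∑∑-hit-meet = trans
      (∑-cong _ λ x → ∑-cong _ λ y →
        proj₂ (hits-split (r x) (c x) (s x) (r y) (c y) (s y) (no-triple x) (no-triple y)))
      (∑∑-+ (∑∑-+ (∑∑-+ (∑∑-* _ _) (∑∑-* _ _)) (∑∑-* _ _))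
            (∑∑-+ (∑∑-+ (∑∑-* _ _) (∑∑-* _ _)) (∑∑-* _ _)))

-- Covers and partial transversals of a Latin square

-- An index for the three directions, so that most arguments about rows, columns and symbols are
-- made once, through `key`.
data Kind : Set where
  ρ κ σ : Kind

∀Kind : {P : Kind → Set} → P ρ × P κ × P σ → ∀ k → P k
∀Kind (p , q , r) ρ = p
∀Kind (p , q , r) κ = q
∀Kind (p , q , r) σ = r

line : ∀ {n} → Kind → Fin n → Line n
line ρ = row
line κ = col
line σ = symb

module _ {n : ℕ} (L : LatinSquare n) where

  key : Kind → Cell n → Fin n
  key ρ (i , j) = i
  key κ (i , j) = j
  key σ (i , j) = entry L i j

  key⇒onLine : ∀ k {ℓ e} → key k e ≡ ℓ → OnLine L (line k ℓ) e
  key⇒onLine ρ eq = eq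
  key⇒onLine κ eq = eq
  key⇒onLine σ eq = eq

  onLine⇒key : ∀ k {ℓ e} → OnLine L (line k ℓ) e → key k e ≡ ℓ
  onLine⇒key ρ eq = eq
  onLine⇒key κ eq = eq
  onLine⇒key σ eq = eq

  KeyCover KeyInjective : Sub n → Set
  KeyCover S     = ∀ k ℓ → ∃[ e ] (e ∈E S × key k e ≡ ℓ)
  KeyInjective S = ∀ k x y → x ∈E S → y ∈E S → key k x ≡ key k y → x ≡ y

  cover⇒ : ∀ {S} → Cover L S → KeyCover S
  cover⇒ c k ℓ = let e , e∈ , on = c (line k ℓ) in e , e∈ , onLine⇒key k on

  ⇒cover : ∀ {S} → KeyCover S → Cover L S
  ⇒cover c (row  ℓ) = c ρ ℓ
  ⇒cover c (col  ℓ) = c κ ℓ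
  ⇒cover c (symb ℓ) = c σ ℓ

  atMostOnce⇒ : ∀ {S} → AtMostOnce L S → KeyInjective S
  atMostOnce⇒ a k x y x∈ y∈ eq =
    a (line k (key k y)) x y x∈ y∈ (key⇒onLine k eq) (key⇒onLine k {e = y} refl)

  ⇒atMostOnce : ∀ {S} → KeyInjective S → AtMostOnce L S
  ⇒atMostOnce a (row  ℓ) x y x∈ y∈ p q = a ρ x y x∈ y∈ (trans p (sym q))
  ⇒atMostOnce a (col  ℓ) x y x∈ y∈ p q = a κ x y x∈ y∈ (trans p (sym q))
  ⇒atMostOnce a (symb ℓ) x y x∈ y∈ p q = a σ x y x∈ y∈ (trans p (sym q))

  latin : ∀ {k k′} → k ≢ k′ → ∀ {x y} → key k x ≡ key k y → key k′ x ≡ key k′ y → x ≡ y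
  latin {ρ} {ρ} k≢ _    _    = contradiction refl k≢
  latin {κ} {κ} k≢ _    _    = contradiction refl k≢
  latin {σ} {σ} k≢ _    _    = contradiction refl k≢
  latin {ρ} {κ} _ refl refl = refl
  latin {κ} {ρ} _ refl refl = refl
  latin {ρ} {σ} _ {i , j} {_ , j′} refl eq   = cong (i ,_) (rowOnce L i j j′ eq)
  latin {σ} {ρ} _ {i , j} {_ , j′} eq   refl = cong (i ,_) (rowOnce L i j j′ eq)
  latin {κ} {σ} _ {i , j} {i′ , _} refl eq   = cong (_, j) (colOnce L j i i′ eq)
  latin {σ} {κ} _ {i , j} {i′ , _} eq   refl = cong (_, j) (colOnce L j i i′ eq)

  crossing : ∀ {k k′} → k ≢ k′ → ∀ a b → ∃[ e ] (key k e ≡ a × key k′ e ≡ b)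
  crossing {ρ} {ρ} k≢ _ _ = contradiction refl k≢
  crossing {κ} {κ} k≢ _ _ = contradiction refl k≢
  crossing {σ} {σ} k≢ _ _ = contradiction refl k≢
  crossing {ρ} {κ} _ a b = (a , b) , refl , refl
  crossing {κ} {ρ} _ a b = (b , a) , refl , refl
  crossing {ρ} {σ} _ a b = let j , eq = rowHas L a b in (a , j) , refl , eq
  crossing {σ} {ρ} _ a b = let j , eq = rowHas L b a in (b , j) , eq , refl
  crossing {κ} {σ} _ a b = let i , eq = colHas L a b in (i , a) , refl , eq
  crossing {σ} {κ} _ a b = let i , eq = colHas L b a in (i , b) , eq , refl

  -- Two of the three lines through e contain the same one of x and y.
  lines-hit⇒≡ : ∀ {e x y} → (∀ k → key k e ≡ key k x ⊎ key k e ≡ key k y) → e ≡ x ⊎ e ≡ y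
  lines-hit⇒≡ h with h ρ | h κ | h σ
  ... | inj₁ p | inj₁ q | _      = inj₁ (latin {ρ} {κ} (λ ()) p q)
  ... | inj₁ p | inj₂ q | inj₁ r = inj₁ (latin {ρ} {σ} (λ ()) p r)
  ... | inj₁ p | inj₂ q | inj₂ r = inj₂ (latin {κ} {σ} (λ ()) q r)
  ... | inj₂ p | inj₁ q | inj₁ r = inj₁ (latin {κ} {σ} (λ ()) q r)
  ... | inj₂ p | inj₁ q | inj₂ r = inj₂ (latin {ρ} {σ} (λ ()) p r)
  ... | inj₂ p | inj₂ q | _      = inj₂ (latin {ρ} {κ} (λ ()) p q)

  module LineCounts (S : Sub n) where

    onLine? : ∀ k ℓ e → Dec (e ∈E S × key k e ≡ ℓ)
    onLine? k ℓ e = (e ∈E? S) ×-dec (key k e == ℓ)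

    lineCount : Kind → Fin n → ℕ
    lineCount k ℓ = count (onLine? k ℓ)

    ∑-lineCount : ∀ k → ∑ (lineCount k) ≡ ∣ S ∣
    ∑-lineCount k = trans (∑-swap _ _ _) (trans (∑-cong _ at) (sym (size≡count S)))
      where
      at : ∀ e → ∑ (λ ℓ → ind (onLine? k ℓ e)) ≡ ind (e ∈E? S)
      at e = begin
        ∑ (λ ℓ → ind (onLine? k ℓ e))                   ≡⟨ ∑-cong _ (λ ℓ → ind-× (e ∈E? S) (key k e == ℓ)) ⟩
        ∑ (λ ℓ → ind (e ∈E? S) * ind (key k e == ℓ))    ≡⟨ ∑-*ˡ (ind (e ∈E? S)) (λ ℓ → ind (key k e == ℓ)) _ ⟩
        ind (e ∈E? S) * ∑ (λ ℓ → ind (key k e == ℓ))    ≡⟨ cong (ind (e ∈E? S) *_) (count≡1 (key k e ==_) (λ p q → trans (sym q) p) (_ , refl)) ⟩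
        ind (e ∈E? S) * 1                               ≡⟨ *-identityʳ _ ⟩
        ind (e ∈E? S)                                   ∎
        where open ≡-Reasoning

    cover⇒≥1 : KeyCover S → ∀ k ℓ → 1 ≤ lineCount k ℓ
    cover⇒≥1 c k ℓ = let _ , p = c k ℓ in count-≥1 (onLine? k ℓ) p

    injective⇒≤1 : KeyInjective S → ∀ k ℓ → lineCount k ℓ ≤ 1
    injective⇒≤1 a k ℓ = count-≤1 (onLine? k ℓ)
      λ (x∈ , p) (y∈ , q) → a k _ _ y∈ x∈ (trans q (sym p))

  open LineCounts

  -- With n entries on n lines of each kind, meeting every line and meeting no line twice are the
  -- same condition. Together with the converse below, this makes covers of size n and transversals
  -- interchangeable.
  full-cover⇒injective : ∀ {S} → KeyCover S → ∣ S ∣ ≡ n → KeyInjective S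
  full-cover⇒injective {S} c eq k x y x∈ y∈ kx≡ky = count≡1⇒unique (onLine? S k (key k y))
    (no-excess (lineCount S k) (cover⇒≥1 S c k) (trans (∑-lineCount S k) eq) (key k y))
    (y∈ , refl) (x∈ , kx≡ky)

  full-injective⇒cover : ∀ {S} → KeyInjective S → ∣ S ∣ ≡ n → KeyCover S
  full-injective⇒cover {S} a eq k ℓ = count-witness (onLine? S k ℓ)
    (no-defect (lineCount S k) (injective⇒≤1 S a k) (trans (∑-lineCount S k) eq) ℓ)

  module NearCover {S : Sub n} (nc : NCover L S) where

    private
      cover : KeyCover S
      cover = cover⇒ (proj₁ nc)

      excess : ∀ k → _
      excess k = single-excess (lineCount S k) (cover⇒≥1 S cover k)
                               (trans (∑-lineCount S k) (proj₂ nc))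

    double : Kind → Fin n
    double k = proj₁ (excess k)

    Doubled : Kind → Cell n → Set
    Doubled k e = e ∈E S × key k e ≡ double k

    doubled? : ∀ k e → Dec (Doubled k e)
    doubled? k = onLine? S k (double k)

    count-doubled : ∀ k → count (doubled? k) ≡ 2
    count-doubled k = proj₁ (proj₂ (excess k))

    -- Every line of kind k other than the doubled one carries exactly one entry of S.
    collide : ∀ k {x y} → x ∈E S → y ∈E S → y ≢ x → key k y ≡ key k x → Doubled k x × Doubled k y
    collide k {x} {y} x∈ y∈ y≢x ky≡kx with key k x == double k
    ... | yes p = (x∈ , p) , (y∈ , trans ky≡kx p)
    ... | no ¬p = contradiction
      (≤-trans (count-≥2 (onLine? S k (key k x)) (x∈ , refl) (y∈ , ky≡kx) y≢x)
               (≤-reflexive (proj₂ (proj₂ (excess k)) (key k x) ¬p)))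
      λ { (s≤s ()) }

    partner : ∀ k {x} → Doubled k x →
              ∃[ y ] (y ≢ x × Doubled k y × (∀ {z} → Doubled k z → z ≡ x ⊎ z ≡ y))
    partner k = count≡2⇒pair (doubled? k) (count-doubled k)

    some-doubled : ∀ k → ∃ (Doubled k)
    some-doubled k = count-witness (doubled? k) (count-doubled k)

    Centre : Cell n → Set
    Centre e = ∀ k → Doubled k e

    -- Only a line through e could become uncovered; each of these is doubled, so the partner of e
    -- on it still covers it.
    centre⇒cover : ∀ {e} → Centre e → Cover L (removeE S e)
    centre⇒cover {e} c = ⇒cover λ k ℓ → at k ℓ (cover k ℓ)
      where
      at : ∀ k ℓ → ∃[ x ] (x ∈E S × key k x ≡ ℓ) → ∃[ x ] (x ∈E removeE S e × key k x ≡ ℓ)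
      at k ℓ (x , x∈ , kx) with x == e
      ... | no x≢e = x , ∈-remove⁺ S e x x∈ x≢e , kx
      ... | yes refl = let y , y≢x , (y∈ , ky) , _ = partner k (c k) in
        y , ∈-remove⁺ S e y y∈ y≢x , trans ky (trans (sym (proj₂ (c k))) kx)

    -- Each line through e must be met by another entry of S, and two entries of S share a line only
    -- if it is doubled.
    cover⇒centre : ∀ {e} → e ∈E S → Cover L (removeE S e) → Centre e
    cover⇒centre {e} e∈ c k =
      let x , x∈ , kx = cover⇒ c k (key k e)
          x∈S , x≢e = ∈-remove⁻ S e x x∈
      in proj₁ (collide k e∈ x∈S x≢e kx)

    minimal⇒no-centre : MinimalCover L S → ∀ e → ¬ Centre e
    minimal⇒no-centre (_ , m) e c = m e (proj₁ (c ρ)) (centre⇒cover c)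

    no-centre⇒minimal : (∀ e → ¬ Centre e) → MinimalCover L S
    no-centre⇒minimal nc′ = proj₁ nc , λ e e∈ c → nc′ e (cover⇒centre e∈ c)

  module NearTransversal (n>0 : 1 ≤ n) {T : Sub n} (pt : PartialTransversal L 1 T) where

    private
      injective : KeyInjective T
      injective = atMostOnce⇒ (proj₂ pt)

      size-T : suc ∣ T ∣ ≡ n
      -- The size of T is given as the truncated n ∸ 1, which is one less than n only because n ≥ 1.
      size-T = trans (cong suc (proj₁ pt)) (m+[n∸m]≡n n>0)

      defect : ∀ k → _
      defect k = single-defect (lineCount T k) (injective⇒≤1 T injective k)
                               (trans (cong suc (∑-lineCount T k)) size-T)

    missing : Kind → Fin n
    missing k = proj₁ (defect k)

    missing-avoided : ∀ k {e} → e ∈E T → key k e ≢ missing k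
    missing-avoided k e∈ eq = count-empty (onLine? T k (missing k)) (proj₁ (proj₂ (defect k))) _ (e∈ , eq)

    others-met : ∀ k ℓ → ℓ ≢ missing k → ∃[ e ] (e ∈E T × key k e ≡ ℓ)
    others-met k ℓ ℓ≢ = count-witness (onLine? T k ℓ) (proj₂ (proj₂ (defect k)) ℓ ℓ≢)

    extends : ∀ {e} → (∀ k → key k e ≡ missing k) → KeyInjective (addE T e)
    extends {e} m k x y x∈ y∈ kx≡ky with ∈-add⁻ T e x x∈ | ∈-add⁻ T e y y∈
    ... | inj₁ x∈T  | inj₁ y∈T  = injective k x y x∈T y∈T kx≡ky
    ... | inj₁ x∈T  | inj₂ refl = contradiction (trans kx≡ky (m k)) (missing-avoided k x∈T)
    ... | inj₂ refl | inj₁ y∈T  = contradiction (trans (sym kx≡ky) (m k)) (missing-avoided k y∈T)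
    ... | inj₂ refl | inj₂ refl = refl

    extension-size : ∀ (e : Cell n) → e ∉E T → ∣ addE T e ∣ ≡ n
    extension-size e e∉ = trans (size-add T e e∉) size-T

    -- S = T ∪ {e₁, e₂} is expressed through membership alone, so that it applies both when S arises
    -- from T by additions and when T arises from S by deletions.
    module TwoMore {S : Sub n} {e₁ e₂ : Cell n} (nc : NCover L S)
      (T⊆S : ∀ (x : Cell n) → x ∈E T → x ∈E S) (S⊆ : ∀ (x : Cell n) → x ∈E S → x ∈E T ⊎ x ≡ e₁ ⊎ x ≡ e₂)
      (e₁∈ : e₁ ∈E S) (e₂∈ : e₂ ∈E S) (e₁∉ : e₁ ∉E T) (e₂∉ : e₂ ∉E T) (e₁≢e₂ : e₁ ≢ e₂) where

      -- Suppose S minus e covers. If e is in T, each line through e is met by another entry of S,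
      -- which cannot be in T and so is e₁ or e₂; then e itself would be e₁ or e₂. If e is e₁ or e₂,
      -- then S minus e is a cover of size n, hence injective, and it contains T together with the
      -- other one, against maximality.
      maximal⇒minimal : (∀ e → e ∉E T → ¬ AtMostOnce L (addE T e)) →
                        ∀ e → e ∈E S → ¬ Cover L (removeE S e)
      maximal⇒minimal max e e∈ c with S⊆ e e∈
      ... | inj₁ e∈T = [ (λ { refl → e₁∉ e∈T }) , (λ { refl → e₂∉ e∈T }) ]′ (lines-hit⇒≡ at)
        where
        at : ∀ k → key k e ≡ key k e₁ ⊎ key k e ≡ key k e₂
        at k with cover⇒ c k (key k e)
        ... | x , x∈ , kx with ∈-remove⁻ S e x x∈
        ... | x∈S , x≢e with S⊆ x x∈S
        ... | inj₁ x∈T         = contradiction (injective k x e x∈T e∈T kx) x≢e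
        ... | inj₂ (inj₁ refl) = inj₁ (sym kx)
        ... | inj₂ (inj₂ refl) = inj₂ (sym kx)
      ... | inj₂ e≡ = max e′ e′∉ (⇒atMostOnce λ k x y x∈ y∈ →
                        full-cover⇒injective (cover⇒ c) size-U k x y (sub x x∈) (sub y y∈))
        where
        size-U : ∣ removeE S e ∣ ≡ n
        size-U = suc-injective (trans (sym (size-remove S e e∈)) (proj₂ nc))
        other : ∃[ e′ ] (e′ ∈E S × e′ ∉E T × e′ ≢ e × e ∉E T)
        other = [ (λ { refl → e₂ , e₂∈ , e₂∉ , e₁≢e₂ ∘ sym , e₁∉ })
                , (λ { refl → e₁ , e₁∈ , e₁∉ , e₁≢e₂ , e₂∉ }) ]′ e≡
        e′ = proj₁ other
        e′∉ = proj₁ (proj₂ (proj₂ other))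
        sub : ∀ x → x ∈E addE T e′ → x ∈E removeE S e
        sub x x∈ with ∈-add⁻ T e′ x x∈
        ... | inj₁ x∈T = ∈-remove⁺ S e x (T⊆S x x∈T)
                           λ { refl → proj₂ (proj₂ (proj₂ (proj₂ other))) x∈T }
        ... | inj₂ refl = ∈-remove⁺ S e x (proj₁ (proj₂ other)) (proj₁ (proj₂ (proj₂ (proj₂ other))))

      -- If T plus e were injective, it would have size n and cover. On each line through e the
      -- cover S has an entry, either e₁ or e₂ because one in T would clash with e. Hence e is e₁ or
      -- e₂, and deleting the other one from S leaves a cover.
      minimal⇒maximal : (∀ e → e ∈E S → ¬ Cover L (removeE S e)) →
                        ∀ e → e ∉E T → ¬ AtMostOnce L (addE T e)
      minimal⇒maximal min e e∉ a = min e′ e′∈ (⇒cover λ k ℓ →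
          let x , x∈ , kx = full-injective⇒cover inj (extension-size e e∉) k ℓ in x , sub x x∈ , kx)
        where
        inj : KeyInjective (addE T e)
        inj = atMostOnce⇒ a
        at : ∀ k → key k e ≡ key k e₁ ⊎ key k e ≡ key k e₂
        at k with cover⇒ (proj₁ nc) k (key k e)
        ... | x , x∈S , kx with S⊆ x x∈S
        ... | inj₁ x∈T = contradiction
              (subst (_∈E T) (inj k x e (∈-add⁺ T e x x∈T) (∈-add-self T e) kx) x∈T) e∉
        ... | inj₂ (inj₁ refl) = inj₁ (sym kx)
        ... | inj₂ (inj₂ refl) = inj₂ (sym kx)
        other : ∃[ e′ ] (e′ ∈E S × e′ ∉E T × e ∈E S × e ≢ e′)
        other = [ (λ { refl → e₂ , e₂∈ , e₂∉ , e₁∈ , e₁≢e₂ })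
                , (λ { refl → e₁ , e₁∈ , e₁∉ , e₂∈ , e₁≢e₂ ∘ sym }) ]′ (lines-hit⇒≡ at)
        e′ = proj₁ other
        e′∈ = proj₁ (proj₂ other)
        sub : ∀ x → x ∈E addE T e → x ∈E removeE S e′
        sub x x∈ with ∈-add⁻ T e x x∈
        ... | inj₁ x∈T = ∈-remove⁺ S e′ x (T⊆S x x∈T)
                           λ { refl → proj₁ (proj₂ (proj₂ other)) x∈T }
        ... | inj₂ refl = let _ , _ , _ , e∈ , e≢ = other in ∈-remove⁺ S e′ x e∈ e≢

-- The common setting of the two counts: `F k` consists of the entries of a cover on its doubled
-- line of kind k, or of all cells on the missing line of kind k. Minimality of the cover supplies
-- `no-centre` in the first case, maximality of the partial transversal in the second.
module Flags ⦃ _ : Finite A ⦄ (F : Kind → A → Set) (F? : ∀ k x → Dec (F k x))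
  (no-centre : ∀ x → ¬ (∀ k → F k x)) where

  Hit Meet : A → A → Set
  Hit  x y = (F ρ x ⊎ F ρ y) × (F κ x ⊎ F κ y) × (F σ x ⊎ F σ y)
  Meet x y = (F ρ x × F ρ y) ⊎ (F κ x × F κ y) ⊎ (F σ x × F σ y)

  hit? : ∀ x y → Dec (Hit x y)
  hit? x y = (F? ρ x ⊎-dec F? ρ y) ×-dec (F? κ x ⊎-dec F? κ y) ×-dec (F? σ x ⊎-dec F? σ y)

  meet? : ∀ x y → Dec (Meet x y)
  meet? x y = (F? ρ x ×-dec F? ρ y) ⊎-dec (F? κ x ×-dec F? κ y) ⊎-dec (F? σ x ×-dec F? σ y)

  common : Kind → Kind → ℕ
  common k k′ = count (λ x → F? k x ×-dec F? k′ x)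

  private
    R C S α β γ : ℕ
    R = count (F? ρ)
    C = count (F? κ)
    S = count (F? σ)
    α = common ρ κ
    β = common ρ σ
    γ = common κ σ

    open HittingPairs (does ∘ F? ρ) (does ∘ F? κ) (does ∘ F? σ)
      (λ x → dec-false (F? ρ x ×-dec F? κ x ×-dec F? σ x) (no-centre x ∘ ∀Kind))
      using (∑∑-hit-suc-meet; ∑∑-hit-meet)

  -- If x lay in none of the three sets, y would have to lie in all of them.
  hit⇒left : ∀ {x y} → Hit x y → ∃[ k ] F k x
  hit⇒left (inj₁ p , _ , _) = ρ , p
  hit⇒left (_ , inj₁ p , _) = κ , p
  hit⇒left (_ , _ , inj₁ p) = σ , p
  hit⇒left {y = y} (inj₂ p , inj₂ q , inj₂ r) = contradiction (∀Kind (p , q , r)) (no-centre y)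

  hit-sym : ∀ {x y} → Hit x y → Hit y x
  hit-sym (p , q , r) = swap p , swap q , swap r

  hit⇒≢ : ∀ {x y} → Hit x y → x ≢ y
  hit⇒≢ {x} (p , q , r) refl = no-centre x (∀Kind (reduce p , reduce q , reduce r))

  meet⇒ : ∀ {x y} → Meet x y → ∃[ k ] (F k x × F k y)
  meet⇒ (inj₁ p)        = ρ , p
  meet⇒ (inj₂ (inj₁ p)) = κ , p
  meet⇒ (inj₂ (inj₂ p)) = σ , p

  ⇒meet : ∀ {x y} k → F k x × F k y → Meet x y
  ⇒meet ρ p = inj₁ p
  ⇒meet κ p = inj₂ (inj₁ p)
  ⇒meet σ p = inj₂ (inj₂ p)

  -- Transfers the two counts to pairs `P` and weights `Q`. `Q` will be adjacency; it is compared
  -- with `Meet` on hitting pairs only, since adjacent cells may share a line outside the chosen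
  -- three.
  module _ {P Q : A → A → Set} (P? : ∀ x y → Dec (P x y)) (Q? : ∀ x y → Dec (Q x y))
    (P⇒hit : ∀ {x y} → P x y → Hit x y) (hit⇒P : ∀ {x y} → Hit x y → P x y)
    (Q⇒meet : ∀ {x y} → Hit x y → Q x y → Meet x y)
    (meet⇒Q : ∀ {x y} → Hit x y → Meet x y → Q x y) where

    private
      same : ∀ (g : ℕ → ℕ) x y →
             ind (P? x y) * g (ind (Q? x y)) ≡ ind (hit? x y) * g (ind (meet? x y))
      same g x y with P? x y
      ... | no ¬p = sym (cong (_* g (ind (meet? x y))) (ind-no (hit? x y) (¬p ∘ hit⇒P)))
      ... | yes p = cong₂ (λ a b → a * g b) (sym (ind-yes (hit? x y) h))
                      (ind-cong (Q? x y) (meet? x y) (Q⇒meet h) (meet⇒Q h))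
        where h = P⇒hit p

    ∑∑-suc : ∑ (λ x → ∑ λ y → ind (P? x y) * suc (ind (Q? x y))) ≡
             R * γ + C * β + S * α + (α * S + β * C + γ * R)
    ∑∑-suc = trans (∑-cong _ λ x → ∑-cong _ (same suc x)) ∑∑-hit-suc-meet

    ∑∑-id : ∑ (λ x → ∑ λ y → ind (P? x y) * ind (Q? x y)) ≡
            α * β + α * γ + β * α + (β * γ + γ * α + γ * β)
    ∑∑-id = trans (∑-cong _ λ x → ∑-cong _ (same id x)) ∑∑-hit-meet

-- Pairs removable from a cover, addable to a partial transversal

module _ {n : ℕ} (L : LatinSquare n) where

  adj? : ∀ x y → Dec (Adj L x y)
  adj? (i , j) (i′ , j′) =
    ¬? ((i , j) == (i′ , j′)) ×-dec
    ((i == i′) ⊎-dec (j == j′) ⊎-dec (entry L i j == entry L i′ j′))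

  adj⇒ : ∀ {x y} → Adj L x y → x ≢ y × ∃[ k ] key L k x ≡ key L k y
  adj⇒ (x≢y , inj₁ p)        = x≢y , ρ , p
  adj⇒ (x≢y , inj₂ (inj₁ p)) = x≢y , κ , p
  adj⇒ (x≢y , inj₂ (inj₂ p)) = x≢y , σ , p

  ⇒adj : ∀ {x y} → x ≢ y → ∀ k → key L k x ≡ key L k y → Adj L x y
  ⇒adj x≢y ρ p = x≢y , inj₁ p
  ⇒adj x≢y κ p = x≢y , inj₂ (inj₁ p)
  ⇒adj x≢y σ p = x≢y , inj₂ (inj₂ p)

  count-crossing : ∀ {k k′} → k ≢ k′ → ∀ a b →
                   count (λ e → (key L k e == a) ×-dec (key L k′ e == b)) ≡ 1
  count-crossing {k} {k′} k≢k′ a b = count≡1 (λ e → (key L k e == a) ×-dec (key L k′ e == b))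
    (λ (p , q) (p′ , q′) → latin L k≢k′ (trans p′ (sym p)) (trans q′ (sym q)))
    (crossing L k≢k′ a b)

  count-line : ∀ {k k′} → k ≢ k′ → ∀ a → count (λ e → key L k e == a) ≡ n
  count-line {k} {k′} k≢k′ a = begin
    ∑ (λ e → ind (key L k e == a))
      ≡⟨ ∑-cong _ spread ⟩
    ∑ (λ e → ∑ λ b → ind ((key L k e == a) ×-dec (key L k′ e == b)))
      ≡⟨ ∑-swap _ _ _ ⟩
    ∑ (λ b → count λ e → (key L k e == a) ×-dec (key L k′ e == b))
      ≡⟨ ∑-cong _ (count-crossing k≢k′ a) ⟩
    ∑ {Fin n} (λ _ → 1)
      ≡⟨ ∑-1 ⟩
    n ∎
    where
    open ≡-Reasoning
    spread : ∀ e → ind (key L k e == a) ≡ ∑ λ b → ind ((key L k e == a) ×-dec (key L k′ e == b))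
    spread e = sym (trans (∑-cong _ λ b → ind-× (key L k e == a) (key L k′ e == b))
      (trans (∑-*ˡ (ind (key L k e == a)) (λ b → ind (key L k′ e == b)) _)
      (trans (cong (ind (key L k e == a) *_)
                (count≡1 (key L k′ e ==_) (λ p q → trans (sym q) p) (_ , refl)))
             (*-identityʳ _))))

  -- Pairs are ordered. Placing e₂ in S minus e₁ makes the two entries distinct and matches two
  -- successive deletions; `AddablePair` undoes these in reverse order, e₂ first and e₁ last.
  RemovablePair : Sub n → Cell n → Cell n → Set
  RemovablePair S e₁ e₂ = e₁ ∈E S × e₂ ∈E removeE S e₁ × MaximalPT L 1 (removeE (removeE S e₁) e₂)

  AddablePair : Sub n → Cell n → Cell n → Set
  AddablePair T e₁ e₂ = e₂ ∉E T × e₁ ∉E addE T e₂ × MinNCover L (addE (addE T e₂) e₁)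

module _ {n : ℕ} (L : LatinSquare n) where

  module MinimalNearCover (n>0 : 1 ≤ n) {S : Sub n} (mc : MinNCover L S) where

    open NearCover L (proj₁ mc) public

    no-centre : ∀ e → ¬ Centre e
    no-centre = minimal⇒no-centre (proj₂ mc)

    open Flags Doubled doubled? no-centre public

    adj⇒meet : ∀ {x y} → x ∈E S → y ∈E S → Adj L x y → Meet x y
    adj⇒meet x∈ y∈ a = let x≢y , k , eq = adj⇒ L a in
      ⇒meet k (collide k x∈ y∈ (x≢y ∘ sym) (sym eq))

    meet⇒adj : ∀ {x y} → x ≢ y → Meet x y → Adj L x y
    meet⇒adj x≢y m = let k , (_ , p) , (_ , q) = meet⇒ m in ⇒adj L x≢y k (trans p (sym q))

    hit⇒∈ : ∀ {x y} → Hit x y → x ∈E S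
    hit⇒∈ h = proj₁ (proj₂ (hit⇒left h))

    -- A doubled line carries two entries of S, and what is left is a partial transversal, so it
    -- keeps at most one of them.
    removable⇒hit : ∀ {e₁ e₂} → RemovablePair L S e₁ e₂ → Hit e₁ e₂
    removable⇒hit {e₁} {e₂} (e₁∈ , e₂∈ , (_ , amo) , _) = at ρ , at κ , at σ
      where
      T = removeE (removeE S e₁) e₂
      at : ∀ k → Doubled k e₁ ⊎ Doubled k e₂
      at k = by (∈-remove₂-or-≡ S e₁ e₂ x (proj₁ dx)) (∈-remove₂-or-≡ S e₁ e₂ y (proj₁ dy))
        where
        x = proj₁ (some-doubled k)
        dx = proj₂ (some-doubled k)
        y = proj₁ (partner k dx)
        y≢x = proj₁ (proj₂ (partner k dx))
        dy : Doubled k y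
        dy = proj₁ (proj₂ (proj₂ (partner k dx)))
        moved : ∀ {z} → Doubled k z → z ≡ e₁ ⊎ z ≡ e₂ → Doubled k e₁ ⊎ Doubled k e₂
        moved d (inj₁ z≡e₁) = inj₁ (subst (Doubled k) z≡e₁ d)
        moved d (inj₂ z≡e₂) = inj₂ (subst (Doubled k) z≡e₂ d)
        by : x ∈E T ⊎ x ≡ e₁ ⊎ x ≡ e₂ → y ∈E T ⊎ y ≡ e₁ ⊎ y ≡ e₂ → Doubled k e₁ ⊎ Doubled k e₂
        by (inj₂ p) _        = moved dx p
        by (inj₁ _) (inj₂ q) = moved dy q
        by (inj₁ x∈T) (inj₁ y∈T) = contradiction
          (atMostOnce⇒ L amo k y x y∈T x∈T (trans (proj₂ dy) (sym (proj₂ dx)))) y≢x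

    -- Two remaining entries with a common line would be the two entries of S on the doubled line of
    -- that kind; but e₁ or e₂ lies on that line as well.
    hit⇒removable : ∀ {e₁ e₂} → Hit e₁ e₂ → RemovablePair L S e₁ e₂
    hit⇒removable {e₁} {e₂} h = e₁∈ , e₂∈′ , pt , minimal⇒maximal (proj₂ (proj₂ mc))
      where
      e₁∈ = hit⇒∈ h
      e₂∈ = hit⇒∈ (hit-sym h)
      e₁≢e₂ = hit⇒≢ h
      S₁ = removeE S e₁
      T = removeE S₁ e₂
      e₂∈′ : e₂ ∈E S₁
      e₂∈′ = ∈-remove⁺ S e₁ e₂ e₂∈ (e₁≢e₂ ∘ sym)
      T⇒ : ∀ x → x ∈E T → x ∈E S × x ≢ e₁ × x ≢ e₂
      T⇒ = ∈-remove₂⁻ S e₁ e₂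
      hits-all : ∀ k → Doubled k e₁ ⊎ Doubled k e₂
      hits-all = ∀Kind h
      injective : KeyInjective L T
      injective k x y x∈ y∈ eq = decidable-stable (x == y) λ x≢y →
        let x∈S , x≢e₁ , x≢e₂ = T⇒ x x∈
            y∈S , y≢e₁ , y≢e₂ = T⇒ y y∈
            dx , dy           = collide k x∈S y∈S (x≢y ∘ sym) (sym eq)
            z , _ , _ , only  = partner k dx

            is-partner : ∀ {w} → x ≢ w → Doubled k w → w ≡ z
            is-partner x≢w dw = [ (λ w≡x → contradiction (sym w≡x) x≢w) , id ]′ (only dw)

            avoid : ∀ {e} → x ≢ e → y ≢ e → ¬ Doubled k e
            avoid x≢e y≢e de = y≢e (trans (is-partner x≢y dy) (sym (is-partner x≢e de)))
        in [ avoid x≢e₁ y≢e₁ , avoid x≢e₂ y≢e₂ ]′ (hits-all k)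
      size-T : suc (suc ∣ T ∣) ≡ suc n
      size-T = trans (cong suc (sym (size-remove S₁ e₂ e₂∈′)))
        (trans (sym (size-remove S e₁ e₁∈)) (proj₂ (proj₁ mc)))
      pt : PartialTransversal L 1 T
      pt = cong (_∸ 1) (suc-injective size-T) , ⇒atMostOnce L injective
      open NearTransversal.TwoMore L n>0 pt (proj₁ mc) (λ x → proj₁ ∘ T⇒ x)
        (∈-remove₂-or-≡ S e₁ e₂) e₁∈ e₂∈
        (λ x∈ → proj₁ (proj₂ (T⇒ e₁ x∈)) refl) (λ x∈ → proj₂ (proj₂ (T⇒ e₂ x∈)) refl) e₁≢e₂

    hit-adj⇒meet : ∀ {x y} → Hit x y → Adj L x y → Meet x y
    hit-adj⇒meet h = adj⇒meet (hit⇒∈ h) (hit⇒∈ (hit-sym h))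

    -- Two doubled lines of different kinds cross in one cell of the square, which may or may not
    -- belong to S.
    count-crossing≤1 : ∀ {k k′} → k ≢ k′ → common k k′ ≤ 1
    count-crossing≤1 {k} {k′} k≢k′ = count-≤1 (λ x → doubled? k x ×-dec doubled? k′ x)
      λ ((_ , p) , (_ , q)) ((_ , p′) , (_ , q′)) →
        latin L k≢k′ (trans p′ (sym p)) (trans q′ (sym q))

    module _ (removable? : ∀ e₁ e₂ → Dec (RemovablePair L S e₁ e₂)) where

      private
        α = common ρ κ
        β = common ρ σ
        γ = common κ σ

      removable-suc-adj : ∑ (λ e₁ → ∑ λ e₂ → ind (removable? e₁ e₂) * suc (ind (adj? L e₁ e₂))) ≡
                          4 * (α + β + γ)
      removable-suc-adj = trans
        (∑∑-suc removable? (adj? L) removable⇒hit hit⇒removable hit-adj⇒meet (meet⇒adj ∘ hit⇒≢))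
        (evaluate α β γ (count-doubled ρ) (count-doubled κ) (count-doubled σ))
        where
        four : ∀ a b c → 2 * c + 2 * b + 2 * a + (a * 2 + b * 2 + c * 2) ≡ 4 * (a + b + c)
        four = solve-∀
        evaluate : ∀ a b c {x y z} → x ≡ 2 → y ≡ 2 → z ≡ 2 →
                   x * c + y * b + z * a + (a * z + b * y + c * x) ≡ 4 * (a + b + c)
        evaluate a b c refl refl refl = four a b c

      removable-adj : ∑ (λ e₁ → ∑ λ e₂ → ind (removable? e₁ e₂) * ind (adj? L e₁ e₂)) ≡
                      α * β + α * γ + β * α + (β * γ + γ * α + γ * β)
      removable-adj =
        ∑∑-id removable? (adj? L) removable⇒hit hit⇒removable hit-adj⇒meet (meet⇒adj ∘ hit⇒≢)

module _ {n : ℕ} (L : LatinSquare n) where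

  module MaximalNearTransversal (n>0 : 1 ≤ n) {T : Sub n} (mt : MaximalPT L 1 T) where

    open NearTransversal L n>0 (proj₁ mt)

    Misses : Kind → Cell n → Set
    Misses k e = key L k e ≡ missing k

    -- A cell on all three missing lines could be added to T.
    no-centre : ∀ e → ¬ (∀ k → Misses k e)
    no-centre e m = proj₂ mt e (λ e∈ → missing-avoided ρ e∈ (m ρ)) (⇒atMostOnce L (extends m))

    open Flags Misses (λ k e → key L k e == missing k) no-centre

    -- If x and y share a line of kind k, then since one of them lies on the missing line of kind k,
    -- the shared line is that missing line.
    adj⇒meet : ∀ {x y} → Hit x y → Adj L x y → Meet x y
    adj⇒meet {x} {y} h a = ⇒meet k (both (hits-all k))
      where
      k = proj₁ (proj₂ (adj⇒ L a))
      eq = proj₂ (proj₂ (adj⇒ L a))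
      hits-all : ∀ k → Misses k x ⊎ Misses k y
      hits-all = ∀Kind h
      both : Misses k x ⊎ Misses k y → Misses k x × Misses k y
      both = [ (λ p → p , trans (sym eq) p) , (λ q → trans eq q , q) ]′

    meet⇒adj : ∀ {x y} → Hit x y → Meet x y → Adj L x y
    meet⇒adj h m = let k , p , q = meet⇒ m in ⇒adj L (hit⇒≢ h) k (trans p (sym q))

    hit⇒∉ : ∀ {x y} → Hit x y → x ∉E T
    hit⇒∉ h x∈ = let k , p = hit⇒left h in missing-avoided k x∈ p

    addable⇒hit : ∀ {e₁ e₂} → AddablePair L T e₁ e₂ → Hit e₁ e₂
    addable⇒hit {e₁} {e₂} (_ , _ , (cov , _) , _) = at ρ , at κ , at σ
      where
      at : ∀ k → Misses k e₁ ⊎ Misses k e₂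
      at k = let x , x∈ , eq = cover⇒ L cov k (missing k) in by eq (∈-add₂⁻ T e₁ e₂ x x∈)
        where
        by : ∀ {x} → Misses k x → x ∈E T ⊎ x ≡ e₁ ⊎ x ≡ e₂ → Misses k e₁ ⊎ Misses k e₂
        by eq (inj₁ x∈T)         = contradiction eq (missing-avoided k x∈T)
        by eq (inj₂ (inj₁ refl)) = inj₁ eq
        by eq (inj₂ (inj₂ refl)) = inj₂ eq

    hit⇒addable : ∀ {e₁ e₂} → Hit e₁ e₂ → AddablePair L T e₁ e₂
    hit⇒addable {e₁} {e₂} h = e₂∉ , e₁∉₂ , nc , proj₁ nc , maximal⇒minimal (proj₂ mt)
      where
      e₁∉ = hit⇒∉ h
      e₂∉ = hit⇒∉ (hit-sym h)
      e₁≢e₂ = hit⇒≢ h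
      T₂ = addE T e₂
      S = addE T₂ e₁
      e₁∉₂ : e₁ ∉E T₂
      e₁∉₂ e₁∈ = [ e₁∉ , e₁≢e₂ ]′ (∈-add⁻ T e₂ e₁ e₁∈)
      T⊆S : ∀ x → x ∈E T → x ∈E S
      T⊆S x x∈ = ∈-add⁺ T₂ e₁ x (∈-add⁺ T e₂ x x∈)
      e₁∈ : e₁ ∈E S
      e₁∈ = ∈-add-self T₂ e₁
      e₂∈ : e₂ ∈E S
      e₂∈ = ∈-add⁺ T₂ e₁ e₂ (∈-add-self T e₂)
      hits-all : ∀ k → Misses k e₁ ⊎ Misses k e₂
      hits-all = ∀Kind h
      covers : KeyCover L S
      covers k ℓ = by (ℓ == missing k)
        where
        by : Dec (ℓ ≡ missing k) → ∃[ e ] (e ∈E S × key L k e ≡ ℓ)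
        by (no ℓ≢) = let x , x∈ , eq = others-met k ℓ ℓ≢ in x , T⊆S x x∈ , eq
        by (yes refl) = [ (λ p → e₁ , e₁∈ , p) , (λ q → e₂ , e₂∈ , q) ]′ (hits-all k)
      nc : NCover L S
      nc = ⇒cover L covers , trans (size-add T₂ e₁ e₁∉₂) (cong suc (extension-size e₂ e₂∉))
      open TwoMore nc T⊆S (∈-add₂⁻ T e₁ e₂) e₁∈ e₂∈ e₁∉ e₂∉ e₁≢e₂

    module _ (addable? : ∀ e₁ e₂ → Dec (AddablePair L T e₁ e₂)) where

      addable-suc-adj : ∑ (λ e₁ → ∑ λ e₂ → ind (addable? e₁ e₂) * suc (ind (adj? L e₁ e₂))) ≡ 6 * n
      addable-suc-adj = trans
        (∑∑-suc addable? (adj? L) addable⇒hit hit⇒addable adj⇒meet meet⇒adj)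
        (evaluate (line-size ρ κ λ ()) (line-size κ ρ λ ()) (line-size σ ρ λ ())
                  (cross ρ κ λ ()) (cross ρ σ λ ()) (cross κ σ λ ()))
        where
        line-size : ∀ k k′ → k ≢ k′ → count (λ e → key L k e == missing k) ≡ n
        line-size k k′ k≢k′ = count-line L k≢k′ (missing k)
        cross : ∀ k k′ → k ≢ k′ → common k k′ ≡ 1
        cross k k′ k≢k′ = count-crossing L k≢k′ (missing k) (missing k′)
        six : ∀ m → m * 1 + m * 1 + m * 1 + (1 * m + 1 * m + 1 * m) ≡ 6 * m
        six = solve-∀
        evaluate : ∀ {x y z a b c} → x ≡ n → y ≡ n → z ≡ n → a ≡ 1 → b ≡ 1 → c ≡ 1 →
                   x * c + y * b + z * a + (a * z + b * y + c * x) ≡ 6 * n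
        evaluate refl refl refl refl refl refl = six n

      addable-adj : ∑ (λ e₁ → ∑ λ e₂ → ind (addable? e₁ e₂) * ind (adj? L e₁ e₂)) ≡ 6
      addable-adj = trans
        (∑∑-id addable? (adj? L) addable⇒hit hit⇒addable adj⇒meet meet⇒adj)
        (evaluate (cross ρ κ λ ()) (cross ρ σ λ ()) (cross κ σ λ ()))
        where
        cross : ∀ k k′ → k ≢ k′ → common k k′ ≡ 1
        cross k k′ k≢k′ = count-crossing L k≢k′ (missing k) (missing k′)
        evaluate : ∀ {a b c} → a ≡ 1 → b ≡ 1 → c ≡ 1 →
                   a * b + a * c + b * a + (b * c + c * a + c * b) ≡ 6
        evaluate refl refl refl = refl

-- The graph of an (n+1)-cover

gEdge? : ∀ G u w → Dec (GEdge G u w)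
gEdge? G u w = ∈?-via _==_ (u , w) (edges G) ⊎-dec ∈?-via _==_ (w , u) (edges G)

NoIsolated : SmallGraph → Set
NoIsolated G = ∀ u → ∃[ w ] GEdge G u w

noIsolated? : ∀ G → Dec (NoIsolated G)
noIsolated? G = all? λ u → any? λ w → gEdge? G u w

-- Separates G₃ from G₄, which have equally many vertices: the centre of the star is joined to all
-- others, while every vertex of the path has a non-neighbour.
NoDominating : SmallGraph → Set
NoDominating G = ∀ u → ∃[ w ] (w ≢ u × ¬ GEdge G u w)

noDominating? : ∀ G → Dec (NoDominating G)
noDominating? G = all? λ u → any? λ w → ¬? (w == u) ×-dec ¬? (gEdge? G u w)

module _ {n : ℕ} (L : LatinSquare n) where

  -- As G has no isolated vertex, its image consists of non-isolated vertices of the induced graph,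
  -- and the map from H reaches all of those.
  inducedIso-size-≤ : ∀ {G H S} → NoIsolated G → InducedIso L G S → InducedIso L H S →
                      size G ≤ size H
  inducedIso-size-≤ {G} {H} ni (f , f-inj , f∈ , f-adj , _) (g , _ , _ , _ , g-onto) =
    injective⇒≤ {f = proj₁ ∘ preimage} λ {u} {w} eq → f-inj u w
      (trans (sym (proj₂ (preimage u))) (trans (cong g eq) (proj₂ (preimage w))))
    where
    preimage : ∀ u → ∃[ w ] g w ≡ f u
    preimage u = let w , uw = ni u in g-onto (f u) (f w) (f∈ u) (f∈ w) (proj₂ (f-adj u w) uw)

  -- The dominating z corresponds to a vertex u of G. A non-neighbour w of u corresponds to some y ≠
  -- z in H, and the edge from z to y would join u to w.
  inducedIso-dominating : ∀ {G H S} → NoIsolated G → NoIsolated H → NoDominating G →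
    InducedIso L G S → InducedIso L H S → ∀ z → ¬ (∀ w → w ≢ z → GEdge H z w)
  inducedIso-dominating {G} {H} niG niH nd (f , f-inj , f∈ , f-adj , f-onto) (g , _ , g∈ , g-adj , g-onto) z dom =
    let z′ , zz′      = niH z
        u , fu≡gz     = f-onto (g z) (g z′) (g∈ z) (g∈ z′) (proj₂ (g-adj z z′) zz′)
        w , w≢u , ¬uw = nd u
        w′ , ww′      = niG w
        y , gy≡fw     = g-onto (f w) (f w′) (f∈ w) (f∈ w′) (proj₂ (f-adj w w′) ww′)
        y≢z           = λ y≡z → w≢u (f-inj w u (trans (sym gy≡fw) (trans (cong g y≡z) (sym fu≡gz))))
    in ¬uw (proj₁ (f-adj u w)
         (subst₂ (Adj L) (sym fu≡gz) gy≡fw (proj₂ (g-adj z y) (dom y y≢z))))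

  inducedIso-size-distinct : ∀ {G H S} → NoIsolated G → size H < size G →
                             InducedIso L G S → InducedIso L H S → Empty.⊥
  inducedIso-size-distinct ni lt p q = <⇒≱ lt (inducedIso-size-≤ ni p q)

  G₃-G₄-distinct : ∀ {S} → InducedIso L G₃ S → InducedIso L G₄ S → Empty.⊥
  G₃-G₄-distinct p q = inducedIso-dominating (from-yes (noIsolated? G₃)) (from-yes (noIsolated? G₄))
    (from-yes (noDominating? G₃)) p q zero
    (from-yes (all? λ w → ¬? (w == zero) →-dec gEdge? G₄ zero w))

  module GraphOf {S : Sub n} (nc : NCover L S) where

    open NearCover L nc

    doubled-pair : ∀ k {x y z} → Doubled k x → Doubled k y → x ≢ y → Doubled k z → z ≡ x ⊎ z ≡ y
    doubled-pair k dx dy x≢y dz =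
      let w , _ , _ , only = partner k dx
          y≡w = [ (λ y≡x → contradiction (sym y≡x) x≢y) , id ]′ (only dy)
      in [ inj₁ , (λ z≡w → inj₂ (trans z≡w (sym y≡w))) ]′ (only dz)

    doubled⇒adj : ∀ k {x y} → Doubled k x → Doubled k y → x ≢ y → Adj L x y
    doubled⇒adj k (_ , p) (_ , q) x≢y = ⇒adj L x≢y k (trans p (sym q))

    AllKinds : Kind → Kind → Kind → Set
    AllKinds k₁ k₂ k₃ = ∀ k → k ≡ k₁ ⊎ k ≡ k₂ ⊎ k ≡ k₃

    -- Entries of S are adjacent only as the pair on a doubled line, so it suffices to list the
    -- vertices and to name the doubled line behind each of the three edges. The kinds may come in
    -- any order, so one lemma per graph serves every placement of rows, columns and symbols.
    inducedIso : ∀ (G : SmallGraph) {a₁ b₁ a₂ b₂ a₃ b₃} →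
      edges G ≡ (a₁ , b₁) ∷ (a₂ , b₂) ∷ (a₃ , b₃) ∷ [] →
      a₁ ≢ b₁ → a₂ ≢ b₂ → a₃ ≢ b₃ →
      (xs : Vec (Cell n) (size G)) → VecUnique xs → (∀ u → lookup xs u ∈E S) →
      ∀ {k₁ k₂ k₃} → AllKinds k₁ k₂ k₃ →
      Doubled k₁ (lookup xs a₁) × Doubled k₁ (lookup xs b₁) →
      Doubled k₂ (lookup xs a₂) × Doubled k₂ (lookup xs b₂) →
      Doubled k₃ (lookup xs a₃) × Doubled k₃ (lookup xs b₃) →
      InducedIso L G S
    inducedIso G@record { edges = _ } {a₁} {b₁} {a₂} {b₂} {a₃} {b₃} refl a₁≢b₁ a₂≢b₂ a₃≢b₃
      xs xs-unique xs⊆S {k₁} {k₂} {k₃} kinds d₁ d₂ d₃ =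
      f , f-inj , xs⊆S , (λ u w → adj⇒edge u w , edge⇒adj u w) , onto
      where
      f = lookup xs
      f-inj = lookup-injective xs-unique

      Represented : Cell n → Cell n → Set
      Represented x y = ∃[ u ] ∃[ w ] (GEdge G u w × f u ≡ x × f w ≡ y)

      represent : ∀ k {a b} → (a , b) ∈ₗ edges G → a ≢ b → Doubled k (f a) × Doubled k (f b) →
                  ∀ {x y} → Doubled k x → Doubled k y → x ≢ y → Represented x y
      represent k {a} {b} ab a≢b (da , db) {x} {y} dx dy x≢y = by (only dx) (only dy)
        where
        only : ∀ {z} → Doubled k z → z ≡ f a ⊎ z ≡ f b
        only = doubled-pair k da db (a≢b ∘ f-inj a b)
        by : x ≡ f a ⊎ x ≡ f b → y ≡ f a ⊎ y ≡ f b → Represented x y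
        by (inj₁ p) (inj₁ q) = contradiction (trans p (sym q)) x≢y
        by (inj₁ p) (inj₂ q) = a , b , inj₁ ab , sym p , sym q
        by (inj₂ p) (inj₁ q) = b , a , inj₂ ab , sym p , sym q
        by (inj₂ p) (inj₂ q) = contradiction (trans p (sym q)) x≢y

      represent-adj : ∀ {x y} → x ∈E S → y ∈E S → Adj L x y → Represented x y
      represent-adj {x} {y} x∈ y∈ a = by (kinds k)
        where
        x≢y = proj₁ (adj⇒ L a)
        k = proj₁ (proj₂ (adj⇒ L a))
        both = collide k x∈ y∈ (x≢y ∘ sym) (sym (proj₂ (proj₂ (adj⇒ L a))))
        by : k ≡ k₁ ⊎ k ≡ k₂ ⊎ k ≡ k₃ → Represented x y
        by (inj₁ e) = let dx , dy = subst (λ k → Doubled k x × Doubled k y) e both in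
          represent k₁ (here refl) a₁≢b₁ d₁ dx dy x≢y
        by (inj₂ (inj₁ e)) = let dx , dy = subst (λ k → Doubled k x × Doubled k y) e both in
          represent k₂ (there (here refl)) a₂≢b₂ d₂ dx dy x≢y
        by (inj₂ (inj₂ e)) = let dx , dy = subst (λ k → Doubled k x × Doubled k y) e both in
          represent k₃ (there (there (here refl))) a₃≢b₃ d₃ dx dy x≢y

      adj⇒edge : ∀ u w → Adj L (f u) (f w) → GEdge G u w
      adj⇒edge u w a =
        let u′ , w′ , e , p , q = represent-adj (xs⊆S u) (xs⊆S w) a
        in subst₂ (GEdge G) (f-inj u′ u p) (f-inj w′ w q) e

      listed⇒adj : ∀ {u w} → (u , w) ∈ₗ edges G → Adj L (f u) (f w)
      listed⇒adj (here refl) = doubled⇒adj k₁ (proj₁ d₁) (proj₂ d₁) (a₁≢b₁ ∘ f-inj a₁ b₁)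
      listed⇒adj (there (here refl)) = doubled⇒adj k₂ (proj₁ d₂) (proj₂ d₂) (a₂≢b₂ ∘ f-inj a₂ b₂)
      listed⇒adj (there (there (here refl))) = doubled⇒adj k₃ (proj₁ d₃) (proj₂ d₃) (a₃≢b₃ ∘ f-inj a₃ b₃)

      edge⇒adj : ∀ u w → GEdge G u w → Adj L (f u) (f w)
      edge⇒adj u w (inj₁ e) = listed⇒adj e
      edge⇒adj u w (inj₂ e) = let x≢y , k , eq = adj⇒ L (listed⇒adj e) in ⇒adj L (x≢y ∘ sym) k (sym eq)

      onto : ∀ x y → x ∈E S → y ∈E S → Adj L x y → ∃[ u ] f u ≡ x
      onto x y x∈ y∈ a = let u , _ , _ , p , _ = represent-adj x∈ y∈ a in u , p

    Disjoint : Kind → Kind → Set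
    Disjoint k k′ = ∀ {x} → Doubled k x → ¬ Doubled k′ x

    apart : ∀ {k k′} → Disjoint k k′ → ∀ {x y} → Doubled k x → Doubled k′ y → x ≢ y
    apart k∥k′ dx dy refl = k∥k′ dx dy

    meeting : ∀ {k k′} → k ≢ k′ → ∀ {x y} → Doubled k x × Doubled k′ x → Doubled k y × Doubled k′ y → x ≡ y
    meeting k≢k′ ((_ , p) , (_ , q)) ((_ , p′) , (_ , q′)) =
      latin L k≢k′ (trans p (sym p′)) (trans q (sym q′))

    -- The partners of the common point x of two double lines differ, because
    -- the lines have no further common point.
    partners-differ : ∀ {k k′} → k ≢ k′ → ∀ {x a b} → Doubled k x × Doubled k′ x →
                      a ≢ x → Doubled k a → Doubled k′ b → a ≢ b
    partners-differ k≢k′ x∈ a≢x da db refl = a≢x (meeting k≢k′ (da , db) x∈)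

    module _ {k₁ k₂ k₃ : Kind} (kinds : AllKinds k₁ k₂ k₃) where

      iso-G₁ : Disjoint k₁ k₂ → Disjoint k₁ k₃ → Disjoint k₂ k₃ → InducedIso L G₁ S
      iso-G₁ d₁₂ d₁₃ d₂₃ =
        let a , da = some-doubled k₁ ; a′ , a′≢a , da′ , _ = partner k₁ da
            b , db = some-doubled k₂ ; b′ , b′≢b , db′ , _ = partner k₂ db
            c , dc = some-doubled k₃ ; c′ , c′≢c , dc′ , _ = partner k₃ dc
        in inducedIso G₁ refl (λ ()) (λ ()) (λ ()) (a ∷ a′ ∷ b ∷ b′ ∷ c ∷ c′ ∷ [])
          ( (a′≢a ∘ sym ∷ apart d₁₂ da db ∷ apart d₁₂ da db′ ∷ apart d₁₃ da dc ∷ apart d₁₃ da dc′ ∷ [])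
          ∷ (apart d₁₂ da′ db ∷ apart d₁₂ da′ db′ ∷ apart d₁₃ da′ dc ∷ apart d₁₃ da′ dc′ ∷ [])
          ∷ (b′≢b ∘ sym ∷ apart d₂₃ db dc ∷ apart d₂₃ db dc′ ∷ [])
          ∷ (apart d₂₃ db′ dc ∷ apart d₂₃ db′ dc′ ∷ [])
          ∷ (c′≢c ∘ sym ∷ [])
          ∷ [] ∷ [] )
          (λ { zero → proj₁ da ; (suc zero) → proj₁ da′ ; (suc (suc zero)) → proj₁ db
             ; (suc (suc (suc zero))) → proj₁ db′ ; (suc (suc (suc (suc zero)))) → proj₁ dc
             ; (suc (suc (suc (suc (suc zero))))) → proj₁ dc′ })
          kinds (da , da′) (db , db′) (dc , dc′)

      iso-G₂ : k₁ ≢ k₂ → ∃[ x ] (Doubled k₁ x × Doubled k₂ x) → Disjoint k₁ k₃ → Disjoint k₂ k₃ →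
               InducedIso L G₂ S
      iso-G₂ k₁≢k₂ (x , dx₁ , dx₂) d₁₃ d₂₃ =
        let a , a≢x , da , _ = partner k₁ dx₁
            b , b≢x , db , _ = partner k₂ dx₂
            c , dc = some-doubled k₃ ; c′ , c′≢c , dc′ , _ = partner k₃ dc
        in inducedIso G₂ refl (λ ()) (λ ()) (λ ()) (a ∷ x ∷ b ∷ c ∷ c′ ∷ [])
          ( (a≢x ∷ partners-differ k₁≢k₂ (dx₁ , dx₂) a≢x da db ∷ apart d₁₃ da dc ∷ apart d₁₃ da dc′ ∷ [])
          ∷ (b≢x ∘ sym ∷ apart d₁₃ dx₁ dc ∷ apart d₁₃ dx₁ dc′ ∷ [])
          ∷ (apart d₂₃ db dc ∷ apart d₂₃ db dc′ ∷ [])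
          ∷ (c′≢c ∘ sym ∷ [])
          ∷ [] ∷ [] )
          (λ { zero → proj₁ da ; (suc zero) → proj₁ dx₁ ; (suc (suc zero)) → proj₁ db
             ; (suc (suc (suc zero))) → proj₁ dc ; (suc (suc (suc (suc zero)))) → proj₁ dc′ })
          kinds (da , dx₁) (dx₂ , db) (dc , dc′)

      iso-G₃ : ∃[ x ] (Doubled k₁ x × Doubled k₂ x) → ∃[ y ] (Doubled k₂ y × Doubled k₃ y) →
               Disjoint k₁ k₃ → InducedIso L G₃ S
      iso-G₃ (x , dx₁ , dx₂) (y , dy₂ , dy₃) d₁₃ =
        let a , a≢x , da , _ = partner k₁ dx₁
            b , b≢y , db , _ = partner k₃ dy₃
        in inducedIso G₃ refl (λ ()) (λ ()) (λ ()) (a ∷ x ∷ y ∷ b ∷ [])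
          ( (a≢x ∷ apart d₁₃ da dy₃ ∷ apart d₁₃ da db ∷ [])
          ∷ (apart d₁₃ dx₁ dy₃ ∷ apart d₁₃ dx₁ db ∷ [])
          ∷ (b≢y ∘ sym ∷ [])
          ∷ [] ∷ [] )
          (λ { zero → proj₁ da ; (suc zero) → proj₁ dx₁ ; (suc (suc zero)) → proj₁ dy₂
             ; (suc (suc (suc zero))) → proj₁ db })
          kinds (da , dx₁) (dx₂ , dy₂) (dy₃ , db)

      iso-G₄ : k₁ ≢ k₂ → k₁ ≢ k₃ → k₂ ≢ k₃ →
               ∃[ x ] (Doubled k₁ x × Doubled k₂ x × Doubled k₃ x) → InducedIso L G₄ S
      iso-G₄ k₁≢k₂ k₁≢k₃ k₂≢k₃ (x , dx₁ , dx₂ , dx₃) =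
        let a , a≢x , da , _ = partner k₁ dx₁
            b , b≢x , db , _ = partner k₂ dx₂
            c , c≢x , dc , _ = partner k₃ dx₃
        in inducedIso G₄ refl (λ ()) (λ ()) (λ ()) (x ∷ a ∷ b ∷ c ∷ [])
          ( (a≢x ∘ sym ∷ b≢x ∘ sym ∷ c≢x ∘ sym ∷ [])
          ∷ (partners-differ k₁≢k₂ (dx₁ , dx₂) a≢x da db ∷ partners-differ k₁≢k₃ (dx₁ , dx₃) a≢x da dc ∷ [])
          ∷ (partners-differ k₂≢k₃ (dx₂ , dx₃) b≢x db dc ∷ [])
          ∷ [] ∷ [] )
          (λ { zero → proj₁ dx₁ ; (suc zero) → proj₁ da ; (suc (suc zero)) → proj₁ db
             ; (suc (suc (suc zero))) → proj₁ dc })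
          kinds (dx₁ , da) (dx₂ , db) (dx₃ , dc)

      -- The vertices are the three crossings; two of them coinciding would give a point on all
      -- three doubled lines.
      iso-G₅ : (∀ e → ¬ (Doubled k₁ e × Doubled k₂ e × Doubled k₃ e)) →
               ∃[ x ] (Doubled k₁ x × Doubled k₃ x) → ∃[ y ] (Doubled k₁ y × Doubled k₂ y) →
               ∃[ z ] (Doubled k₂ z × Doubled k₃ z) → InducedIso L G₅ S
      iso-G₅ nc′ (x , dx₁ , dx₃) (y , dy₁ , dy₂) (z , dz₂ , dz₃) =
        inducedIso G₅ refl (λ ()) (λ ()) (λ ()) (x ∷ y ∷ z ∷ [])
          ( ((λ { refl → nc′ x (dx₁ , dy₂ , dx₃) }) ∷ (λ { refl → nc′ x (dx₁ , dz₂ , dx₃) }) ∷ [])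
          ∷ ((λ { refl → nc′ y (dy₁ , dy₂ , dz₃) }) ∷ [])
          ∷ [] ∷ [] )
          (λ { zero → proj₁ dx₁ ; (suc zero) → proj₁ dy₁ ; (suc (suc zero)) → proj₁ dz₂ })
          kinds (dx₁ , dy₁) (dy₂ , dz₂) (dx₃ , dz₃)

    centre⇒G₄ : ∃ Centre → InducedIso L G₄ S
    centre⇒G₄ (e , c) = iso-G₄ {ρ} {κ} {σ} (∀Kind (inj₁ refl , inj₂ (inj₁ refl) , inj₂ (inj₂ refl)))
      (λ ()) (λ ()) (λ ()) (e , c ρ , c κ , c σ)

-- Classification of minimal covers by type

module _ {n : ℕ} (L : LatinSquare n) (n>0 : 1 ≤ n) where

  module Classification {S : Sub n} (mc : MinNCover L S) where

    open MinimalNearCover L n>0 mc public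
    open GraphOf L (proj₁ mc)

    -- The indices are the number of crossings of doubled lines inside S and the number of ordered
    -- pairs of different crossings. Four times the first is the sum with weight 1 + [x ~ y], the
    -- second the sum with weight [x ~ y].
    data Outcome : ℕ → ℕ → Set where
      type₁ : InducedIso L G₁ S → Outcome 0 0
      type₂ : InducedIso L G₂ S → Outcome 1 0
      type₃ : InducedIso L G₃ S → Outcome 2 2
      type₅ : InducedIso L G₅ S → Outcome 3 6

    Meeting : Kind → Kind → Set
    Meeting k k′ = ∃[ x ] (Doubled k x × Doubled k′ x)

    Position : Kind → Kind → ℕ → Set
    Position k k′ a = (a ≡ 0 × Disjoint k k′) ⊎ (a ≡ 1 × Meeting k k′)

    position : ∀ k k′ → k ≢ k′ → Position k k′ (common k k′)
    position k k′ k≢k′ = by (common k k′) refl (count-crossing≤1 k≢k′)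
      where
      both? : ∀ x → Dec (Doubled k x × Doubled k′ x)
      both? x = doubled? k x ×-dec doubled? k′ x
      by : ∀ a → common k k′ ≡ a → a ≤ 1 → Position k k′ a
      by zero          eq _ = inj₁ (refl , λ dx dx′ → count-empty both? eq _ (dx , dx′))
      by (suc zero)    eq _ = inj₂ (refl , count-witness both? eq)
      by (suc (suc _)) _ (s≤s ())

    sym-disjoint : ∀ {k k′} → Disjoint k k′ → Disjoint k′ k
    sym-disjoint d dx′ dx = d dx dx′

    sym-meeting : ∀ {k k′} → Meeting k k′ → Meeting k′ k
    sym-meeting (x , dx , dx′) = x , dx′ , dx

    outcome : ∀ {a b c} → Position ρ κ a → Position ρ σ b → Position κ σ c →
              Outcome (a + b + c) (a * b + a * c + b * a + (b * c + c * a + c * b))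
    outcome (inj₁ (refl , ρκ)) (inj₁ (refl , ρσ)) (inj₁ (refl , κσ)) =
      type₁ (iso-G₁ {ρ} {κ} {σ} (∀Kind (inj₁ refl , inj₂ (inj₁ refl) , inj₂ (inj₂ refl))) ρκ ρσ κσ)
    outcome (inj₂ (refl , ρκ)) (inj₁ (refl , ρσ)) (inj₁ (refl , κσ)) =
      type₂ (iso-G₂ {ρ} {κ} {σ} (∀Kind (inj₁ refl , inj₂ (inj₁ refl) , inj₂ (inj₂ refl))) (λ ()) ρκ ρσ κσ)
    outcome (inj₁ (refl , ρκ)) (inj₂ (refl , ρσ)) (inj₁ (refl , κσ)) =
      type₂ (iso-G₂ {ρ} {σ} {κ} (∀Kind (inj₁ refl , inj₂ (inj₂ refl) , inj₂ (inj₁ refl))) (λ ()) ρσ ρκ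
        (sym-disjoint {κ} {σ} κσ))
    outcome (inj₁ (refl , ρκ)) (inj₁ (refl , ρσ)) (inj₂ (refl , κσ)) =
      type₂ (iso-G₂ {κ} {σ} {ρ} (∀Kind (inj₂ (inj₂ refl) , inj₁ refl , inj₂ (inj₁ refl))) (λ ()) κσ
        (sym-disjoint {ρ} {κ} ρκ) (sym-disjoint {ρ} {σ} ρσ))
    -- The kind passed in the middle, here `ρ`, is that of the doubled line crossing both others;
    -- its two entries form the middle edge of the path.
    outcome (inj₂ (refl , ρκ)) (inj₂ (refl , ρσ)) (inj₁ (refl , κσ)) =
      type₃ (iso-G₃ {κ} {ρ} {σ} (∀Kind (inj₂ (inj₁ refl) , inj₁ refl , inj₂ (inj₂ refl)))
        (sym-meeting {ρ} {κ} ρκ) ρσ κσ)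
    outcome (inj₂ (refl , ρκ)) (inj₁ (refl , ρσ)) (inj₂ (refl , κσ)) =
      type₃ (iso-G₃ {ρ} {κ} {σ} (∀Kind (inj₁ refl , inj₂ (inj₁ refl) , inj₂ (inj₂ refl))) ρκ κσ ρσ)
    outcome (inj₁ (refl , ρκ)) (inj₂ (refl , ρσ)) (inj₂ (refl , κσ)) =
      type₃ (iso-G₃ {ρ} {σ} {κ} (∀Kind (inj₁ refl , inj₂ (inj₂ refl) , inj₂ (inj₁ refl)))
        ρσ (sym-meeting {κ} {σ} κσ) ρκ)
    outcome (inj₂ (refl , ρκ)) (inj₂ (refl , ρσ)) (inj₂ (refl , κσ)) =
      type₅ (iso-G₅ {ρ} {κ} {σ} (∀Kind (inj₁ refl , inj₂ (inj₁ refl) , inj₂ (inj₂ refl)))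
        (λ e p → no-centre e (∀Kind p)) ρσ ρκ κσ)

    meetings meeting-pairs : ℕ
    meetings      = common ρ κ + common ρ σ + common κ σ
    meeting-pairs = common ρ κ * common ρ σ + common ρ κ * common κ σ + common ρ σ * common ρ κ +
      (common ρ σ * common κ σ + common κ σ * common ρ κ + common κ σ * common ρ σ)

    classify : Outcome meetings meeting-pairs
    classify = outcome (position ρ κ λ ()) (position ρ σ λ ()) (position κ σ λ ())

  -- A centre would make the induced graph the star G₄.
  distinct-from-G₄⇒minimal : ∀ {G} → (∀ {S} → InducedIso L G S → InducedIso L G₄ S → Empty.⊥) →
                             ∀ {S} → CoverOfType L G S → MinNCover L S
  distinct-from-G₄⇒minimal G≠G₄ (nc , iso) = nc , NearCover.no-centre⇒minimal L nc
    λ e c → G≠G₄ iso (GraphOf.centre⇒G₄ L nc (e , c))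

  type₁⇒minimal : ∀ {S} → CoverOfType L G₁ S → MinNCover L S
  type₁⇒minimal = distinct-from-G₄⇒minimal
    (inducedIso-size-distinct L (from-yes (noIsolated? G₁)) (from-yes (4 <? 6)))

  type₂⇒minimal : ∀ {S} → CoverOfType L G₂ S → MinNCover L S
  type₂⇒minimal = distinct-from-G₄⇒minimal
    (inducedIso-size-distinct L (from-yes (noIsolated? G₂)) (from-yes (4 <? 5)))

  type₃⇒minimal : ∀ {S} → CoverOfType L G₃ S → MinNCover L S
  type₃⇒minimal = distinct-from-G₄⇒minimal (G₃-G₄-distinct L)

  type₅⇒minimal : ∀ {S} → CoverOfType L G₅ S → MinNCover L S
  type₅⇒minimal = distinct-from-G₄⇒minimal λ p q →
    inducedIso-size-distinct L (from-yes (noIsolated? G₄)) (from-yes (3 <? 4)) q p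

  module TypeIndicators (S : Sub n)
    (d₁ : Dec (CoverOfType L G₁ S)) (d₂ : Dec (CoverOfType L G₂ S))
    (d₃ : Dec (CoverOfType L G₃ S)) (d₅ : Dec (CoverOfType L G₅ S)) where

    -- The contribution of a single S to the formula for qmin and to the two pair counts: m is the
    -- indicator of minimality, c and w are the indices of `Outcome`.
    Split : ℕ → ℕ → ℕ → Set
    Split m c w =
      m ≡ ind d₁ + ind d₂ + ind d₃ + ind d₅ ×
      m * (4 * c) ≡ 4 * ind d₂ + 8 * ind d₃ + 12 * ind d₅ ×
      m * w ≡ 2 * ind d₃ + 6 * ind d₅

    private
      Split′ : (m c w i₁ i₂ i₃ i₅ : ℕ) → Set
      Split′ m c w i₁ i₂ i₃ i₅ =
        m ≡ i₁ + i₂ + i₃ + i₅ × m * (4 * c) ≡ 4 * i₂ + 8 * i₃ + 12 * i₅ × m * w ≡ 2 * i₃ + 6 * i₅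

      from : ∀ {m c w i₁ i₂ i₃ i₅} → ind d₁ ≡ i₁ → ind d₂ ≡ i₂ → ind d₃ ≡ i₃ → ind d₅ ≡ i₅ →
             Split′ m c w i₁ i₂ i₃ i₅ → Split m c w
      from refl refl refl refl s = s

      bigger : ∀ {G H} → NoIsolated G → size H < size G → InducedIso L G S → ¬ CoverOfType L H S
      bigger ni lt p (_ , q) = inducedIso-size-distinct L ni lt p q

      smaller : ∀ {G H} → NoIsolated H → size G < size H → InducedIso L G S → ¬ CoverOfType L H S
      smaller ni lt p (_ , q) = inducedIso-size-distinct L ni lt q p

    split-no : ¬ MinNCover L S → ∀ c w → Split 0 c w
    split-no ¬m c w = from {0} {c} {w} (ind-no d₁ (¬m ∘ type₁⇒minimal)) (ind-no d₂ (¬m ∘ type₂⇒minimal))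
      (ind-no d₃ (¬m ∘ type₃⇒minimal)) (ind-no d₅ (¬m ∘ type₅⇒minimal)) (refl , refl , refl)

    module _ (mc : MinNCover L S) where

      open Classification mc

      private
        NI₁ = from-yes (noIsolated? G₁)
        NI₂ = from-yes (noIsolated? G₂)
        NI₃ = from-yes (noIsolated? G₃)

      split-outcome : ∀ {c w} → Outcome c w → Split 1 c w
      split-outcome (type₁ p) = from {1} {0} {0} (ind-yes d₁ (proj₁ mc , p))
        (ind-no d₂ (bigger {H = G₂} NI₁ (from-yes (5 <? 6)) p))
        (ind-no d₃ (bigger {H = G₃} NI₁ (from-yes (4 <? 6)) p))
        (ind-no d₅ (bigger {H = G₅} NI₁ (from-yes (3 <? 6)) p)) (refl , refl , refl)
      split-outcome (type₂ p) = from {1} {1} {0} (ind-no d₁ (smaller {G = G₂} NI₁ (from-yes (5 <? 6)) p))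
        (ind-yes d₂ (proj₁ mc , p))
        (ind-no d₃ (bigger {H = G₃} NI₂ (from-yes (4 <? 5)) p))
        (ind-no d₅ (bigger {H = G₅} NI₂ (from-yes (3 <? 5)) p)) (refl , refl , refl)
      split-outcome (type₃ p) = from {1} {2} {2} (ind-no d₁ (smaller {G = G₃} NI₁ (from-yes (4 <? 6)) p))
        (ind-no d₂ (smaller {G = G₃} NI₂ (from-yes (4 <? 5)) p))
        (ind-yes d₃ (proj₁ mc , p))
        (ind-no d₅ (bigger {H = G₅} NI₃ (from-yes (3 <? 4)) p)) (refl , refl , refl)
      split-outcome (type₅ p) = from {1} {3} {6} (ind-no d₁ (smaller {G = G₅} NI₁ (from-yes (3 <? 6)) p))
        (ind-no d₂ (smaller {G = G₅} NI₂ (from-yes (3 <? 5)) p))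
        (ind-no d₃ (smaller {G = G₅} NI₃ (from-yes (3 <? 4)) p))
        (ind-yes d₅ (proj₁ mc , p)) (refl , refl , refl)

      split-yes : Split 1 meetings meeting-pairs
      split-yes = split-outcome classify

-- Double counting

module PairCounting {n : ℕ} (L : LatinSquare n) (n>0 : 1 ≤ n)
  (min? : ∀ S → Dec (MinNCover L S)) (max? : ∀ T → Dec (MaximalPT L 1 T)) where

  removable? : ∀ S e₁ e₂ → Dec (RemovablePair L S e₁ e₂)
  removable? S e₁ e₂ = (e₁ ∈E? S) ×-dec (e₂ ∈E? removeE S e₁) ×-dec max? (removeE (removeE S e₁) e₂)

  addable? : ∀ T e₁ e₂ → Dec (AddablePair L T e₁ e₂)
  addable? T e₁ e₂ = ¬? (e₂ ∈E? T) ×-dec ¬? (e₁ ∈E? addE T e₂) ×-dec min? (addE (addE T e₂) e₁)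

  private
    reorder : ∀ m a b c w → a * (b * (m * (c * w))) ≡ m * (a * (b * c) * w)
    reorder = solve-∀

    reorder′ : ∀ m a b c w → a * (b * (c * (m * w))) ≡ m * (a * (b * c) * w)
    reorder′ = solve-∀

    ind-×₃ : ∀ {P Q R : Set} (p : Dec P) (q : Dec Q) (r : Dec R) →
             ind p * (ind q * ind r) ≡ ind (p ×-dec q ×-dec r)
    ind-×₃ p q r = sym (trans (ind-× p (q ×-dec r)) (cong (ind p *_) (ind-× q r)))

  ∑∑-factor : ∀ m (a : Cell n → ℕ) (f g : Cell n → Cell n → ℕ) →
              (∀ x y → a x * f x y ≡ m * g x y) →
              ∑ (λ x → a x * ∑ (f x)) ≡ m * ∑ (λ x → ∑ (g x))
  ∑∑-factor m a f g eq = trans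
    (∑-cong _ λ x → trans (sym (∑-*ˡ (a x) (f x) _))
      (trans (∑-cong _ (eq x)) (∑-*ˡ m (g x) _)))
    (∑-*ˡ m (λ x → ∑ (g x)) _)

  module _ (w : Cell n → Cell n → ℕ) where

    private
      Φ : Sub n → Cell n → Cell n → Sub n → ℕ
      Φ S e₁ e₂ T = ind (min? S) * (ind (max? T) * w e₁ e₂)

    -- Both sides sum over triples (S, e₁, e₂) with T = S - e₁ - e₂. The passage goes through U = S
    -- - e₁ = T + e₂: the outer sum moves from S to U, the sums over e₁ and e₂ are exchanged, and
    -- the outer sum moves from U to T. The weight is arbitrary, so one argument yields both
    -- identities.
    double-counting :
      ∑Sub {n} (λ S → ind (min? S) * ∑ λ e₁ → ∑ λ e₂ → ind (removable? S e₁ e₂) * w e₁ e₂) ≡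
      ∑Sub {n} (λ T → ind (max? T) * ∑ λ e₁ → ∑ λ e₂ → ind (addable? T e₁ e₂) * w e₁ e₂)
    double-counting = begin
      ∑Sub {n} (λ S → ind (min? S) * ∑ λ e₁ → ∑ λ e₂ → ind (removable? S e₁ e₂) * w e₁ e₂)
        ≡⟨ ∑-cong _ (λ S → ∑∑-factor (ind (min? S)) (λ e₁ → ind (e₁ ∈E? S)) _ _ λ e₁ e₂ →
             trans (reorder (ind (min? S)) (ind (e₁ ∈E? S)) (ind (e₂ ∈E? removeE S e₁)) (ind (max? (removeE (removeE S e₁) e₂))) (w e₁ e₂))
               (cong (λ p → ind (min? S) * (p * w e₁ e₂))
                 (ind-×₃ (e₁ ∈E? S) (e₂ ∈E? removeE S e₁) (max? (removeE (removeE S e₁) e₂))))) ⟨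
      ∑Sub {n} (λ S → ∑ λ e₁ → ind (e₁ ∈E? S) *
        ∑ λ e₂ → ind (e₂ ∈E? removeE S e₁) * Φ S e₁ e₂ (removeE (removeE S e₁) e₂))
        ≡⟨ ∑∑-toggle (λ e₁ S U → ∑ λ e₂ → ind (e₂ ∈E? U) * Φ S e₁ e₂ (removeE U e₂)) ⟩
      ∑Sub {n} (λ U → ∑ λ e₁ → ind (¬? (e₁ ∈E? U)) *
        ∑ λ e₂ → ind (e₂ ∈E? U) * Φ (addE U e₁) e₁ e₂ (removeE U e₂))
        ≡⟨ ∑-cong _ exchange ⟩
      ∑Sub {n} (λ U → ∑ λ e₂ → ind (e₂ ∈E? U) *
        ∑ λ e₁ → ind (¬? (e₁ ∈E? U)) * Φ (addE U e₁) e₁ e₂ (removeE U e₂))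
        ≡⟨ ∑∑-toggle (λ e₂ U T → ∑ λ e₁ → ind (¬? (e₁ ∈E? U)) * Φ (addE U e₁) e₁ e₂ T) ⟩
      ∑Sub {n} (λ T → ∑ λ e₂ → ind (¬? (e₂ ∈E? T)) *
        ∑ λ e₁ → ind (¬? (e₁ ∈E? addE T e₂)) * Φ (addE (addE T e₂) e₁) e₁ e₂ T)
        ≡⟨ ∑-cong _ (λ T → trans
             (∑∑-factor (ind (max? T)) (λ e₂ → ind (¬? (e₂ ∈E? T))) _ _ λ e₂ e₁ →
               trans (reorder′ (ind (max? T)) (ind (¬? (e₂ ∈E? T))) (ind (¬? (e₁ ∈E? addE T e₂))) (ind (min? (addE (addE T e₂) e₁))) (w e₁ e₂))
                 (cong (λ p → ind (max? T) * (p * w e₁ e₂))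
                   (ind-×₃ (¬? (e₂ ∈E? T)) (¬? (e₁ ∈E? addE T e₂)) (min? (addE (addE T e₂) e₁)))))
             (cong (ind (max? T) *_) (∑-swap _ _ _))) ⟩
      ∑Sub {n} (λ T → ind (max? T) * ∑ λ e₁ → ∑ λ e₂ → ind (addable? T e₁ e₂) * w e₁ e₂) ∎
      where
      open ≡-Reasoning
      exchange : ∀ U →
        ∑ (λ e₁ → ind (¬? (e₁ ∈E? U)) * ∑ λ e₂ → ind (e₂ ∈E? U) * Φ (addE U e₁) e₁ e₂ (removeE U e₂)) ≡
        ∑ (λ e₂ → ind (e₂ ∈E? U) * ∑ λ e₁ → ind (¬? (e₁ ∈E? U)) * Φ (addE U e₁) e₁ e₂ (removeE U e₂))
      exchange U = begin
        ∑ (λ e₁ → ind (¬? (e₁ ∈E? U)) * ∑ λ e₂ → ind (e₂ ∈E? U) * φ e₁ e₂)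
          ≡⟨ ∑-cong _ (λ e₁ → sym (∑-*ˡ (ind (¬? (e₁ ∈E? U))) (λ e₂ → ind (e₂ ∈E? U) * φ e₁ e₂) _)) ⟩
        ∑ (λ e₁ → ∑ λ e₂ → ind (¬? (e₁ ∈E? U)) * (ind (e₂ ∈E? U) * φ e₁ e₂))
          ≡⟨ ∑-swap _ _ _ ⟩
        ∑ (λ e₂ → ∑ λ e₁ → ind (¬? (e₁ ∈E? U)) * (ind (e₂ ∈E? U) * φ e₁ e₂))
          ≡⟨ ∑-cong _ (λ e₂ → ∑-cong _ λ e₁ →
               x∙yz≈y∙xz (ind (¬? (e₁ ∈E? U))) (ind (e₂ ∈E? U)) (φ e₁ e₂)) ⟩
        ∑ (λ e₂ → ∑ λ e₁ → ind (e₂ ∈E? U) * (ind (¬? (e₁ ∈E? U)) * φ e₁ e₂))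
          ≡⟨ ∑-cong _ (λ e₂ → ∑-*ˡ (ind (e₂ ∈E? U)) (λ e₁ → ind (¬? (e₁ ∈E? U)) * φ e₁ e₂) _) ⟩
        ∑ (λ e₂ → ind (e₂ ∈E? U) * ∑ λ e₁ → ind (¬? (e₁ ∈E? U)) * φ e₁ e₂) ∎
        where
        φ : Cell n → Cell n → ℕ
        φ e₁ e₂ = Φ (addE U e₁) e₁ e₂ (removeE U e₂)

    constant-right : ∀ c → (∀ T → MaximalPT L 1 T → ∑ (λ e₁ → ∑ λ e₂ → ind (addable? T e₁ e₂) * w e₁ e₂) ≡ c) →
      ∑Sub {n} (λ T → ind (max? T) * ∑ λ e₁ → ∑ λ e₂ → ind (addable? T e₁ e₂) * w e₁ e₂) ≡
      ∑Sub {n} (λ T → ind (max? T)) * c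
    constant-right c eq = trans (∑-cong _ λ T → at T (max? T)) (∑-*ʳ (λ T → ind (max? T)) c _)
      where
      at : ∀ T (d : Dec (MaximalPT L 1 T)) →
           ind d * ∑ (λ e₁ → ∑ λ e₂ → ind (addable? T e₁ e₂) * w e₁ e₂) ≡ ind d * c
      at T (yes m) = cong (1 *_) (eq T m)
      at T (no _)  = refl

  pairs-with-max : ∀ {p} → p ≡ ∑Sub {n} (λ T → ind (max? T)) →
    ∑Sub {n} (λ S → ind (min? S) * ∑ λ e₁ → ∑ λ e₂ → ind (removable? S e₁ e₂) * suc (ind (adj? L e₁ e₂)))
      ≡ p * (6 * n) ×
    ∑Sub {n} (λ S → ind (min? S) * ∑ λ e₁ → ∑ λ e₂ → ind (removable? S e₁ e₂) * ind (adj? L e₁ e₂))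
      ≡ p * 6
  pairs-with-max refl =
      trans (double-counting _) (constant-right _ (6 * n) λ T m →
        MaximalNearTransversal.addable-suc-adj L n>0 m (addable? T))
    , trans (double-counting _) (constant-right _ 6 λ T m →
        MaximalNearTransversal.addable-adj L n>0 m (addable? T))

  module _ (d₁ : ∀ S → Dec (CoverOfType L G₁ S)) (d₂ : ∀ S → Dec (CoverOfType L G₂ S))
           (d₃ : ∀ S → Dec (CoverOfType L G₃ S)) (d₅ : ∀ S → Dec (CoverOfType L G₅ S)) where

    pairs-by-type : ∀ S →
      ind (min? S) ≡ ind (d₁ S) + ind (d₂ S) + ind (d₃ S) + ind (d₅ S) ×
      ind (min? S) * ∑ (λ e₁ → ∑ λ e₂ → ind (removable? S e₁ e₂) * suc (ind (adj? L e₁ e₂)))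
        ≡ 4 * ind (d₂ S) + 8 * ind (d₃ S) + 12 * ind (d₅ S) ×
      ind (min? S) * ∑ (λ e₁ → ∑ λ e₂ → ind (removable? S e₁ e₂) * ind (adj? L e₁ e₂))
        ≡ 2 * ind (d₃ S) + 6 * ind (d₅ S)
    pairs-by-type S = by (min? S)
      where
      open TypeIndicators L n>0 S (d₁ S) (d₂ S) (d₃ S) (d₅ S)
      U = ∑ λ e₁ → ∑ λ e₂ → ind (removable? S e₁ e₂) * suc (ind (adj? L e₁ e₂))
      W = ∑ λ e₁ → ∑ λ e₂ → ind (removable? S e₁ e₂) * ind (adj? L e₁ e₂)
      by : (d : Dec (MinNCover L S)) →
        ind d ≡ ind (d₁ S) + ind (d₂ S) + ind (d₃ S) + ind (d₅ S) ×
        ind d * U ≡ 4 * ind (d₂ S) + 8 * ind (d₃ S) + 12 * ind (d₅ S) ×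
        ind d * W ≡ 2 * ind (d₃ S) + 6 * ind (d₅ S)
      -- For a non-minimal S the pair sums are multiplied by 0, so zeros stand in for them.
      by (no ¬m) = split-no ¬m 0 0
      by (yes m) = let p , q , r = split-yes m in
          p
        , trans (cong (1 *_) (MinimalNearCover.removable-suc-adj L n>0 m (removable? S))) q
        , trans (cong (1 *_) (MinimalNearCover.removable-adj L n>0 m (removable? S))) r

-- Transversals, their deletions and their extensions

module TransversalCounting {n : ℕ} (L : LatinSquare n) (n>0 : 1 ≤ n)
  (tr? : ∀ S → Dec (Transversal L S)) where

  private
    t : ℕ
    t = ∑Sub {n} (ind ∘ tr?)

  transversal⇒cover : ∀ {S} → Transversal L S → Cover L S
  transversal⇒cover (eq , amo) = ⇒cover L (full-injective⇒cover L (atMostOnce⇒ L amo) eq)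

  tr-size : ∀ (g : ℕ → ℕ) S → ind (tr? S) * g ∣ S ∣ ≡ ind (tr? S) * g n
  tr-size g S = by (tr? S)
    where
    by : (d : Dec (Transversal L S)) → ind d * g ∣ S ∣ ≡ ind d * g n
    by (yes (eq , _)) = cong (λ k → 1 * g k) eq
    by (no _)         = refl

  ∑-cells : ∑ {Cell n} (λ _ → 1) ≡ n * n
  ∑-cells = begin
    ∑ {Cell n} (λ _ → 1)
      ≡⟨ ∑-cong _ (λ e → sym (count≡1 (proj₁ e ==_) (λ p q → trans (sym q) p) (_ , refl))) ⟩
    ∑ (λ (e : Cell n) → ∑ λ i → ind (proj₁ e == i))
      ≡⟨ ∑-swap _ _ _ ⟩
    ∑ (λ i → count λ (e : Cell n) → proj₁ e == i)
      ≡⟨ ∑-cong _ (λ i → trans (count-line L {ρ} {κ} (λ ()) i) (sym (*-identityʳ n))) ⟩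
    ∑ {Fin n} (λ _ → n * 1)
      ≡⟨ ∑-*ˡ n (λ _ → 1) _ ⟩
    n * ∑ {Fin n} (λ _ → 1)
      ≡⟨ cong (n *_) ∑-1 ⟩
    n * n ∎
    where open ≡-Reasoning

  complement-size : ∀ S → ∣ S ∣ + count (λ (e : Cell n) → ¬? (e ∈E? S)) ≡ n * n
  complement-size S = begin
    ∣ S ∣ + outside-count                                    ≡⟨ cong (_+ outside-count) (size≡count S) ⟩
    count (λ (e : Cell n) → e ∈E? S) + outside-count          ≡⟨ ∑-+ _ _ _ ⟨
    ∑ (λ (e : Cell n) → ind (e ∈E? S) + ind (¬? (e ∈E? S)))   ≡⟨ ∑-cong _ (λ e → one (does (e ∈E? S))) ⟩
    ∑ {Cell n} (λ _ → 1)                                      ≡⟨ ∑-cells ⟩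
    n * n                                                     ∎
    where
    open ≡-Reasoning
    outside-count = count (λ (e : Cell n) → ¬? (e ∈E? S))
    one : ∀ b → 𝟙 b + 𝟙 (not b) ≡ 1
    one true  = refl
    one false = refl

  -- `a S` will count the entries in S or the cells outside it, so its sum depends on the size of S
  -- alone; that size is n wherever the indicator of a transversal is nonzero.
  ∑-weight : ∀ (a : Sub n → Cell n → ℕ) (g : ℕ → ℕ) → (∀ S → ∑ (a S) ≡ g ∣ S ∣) →
             ∑Sub {n} (λ S → ∑ λ e → a S e * ind (tr? S)) ≡ t * g n
  ∑-weight a g eq = trans
    (∑-cong _ λ S → trans (∑-*ʳ (a S) (ind (tr? S)) _)
      (trans (*-comm (∑ (a S)) (ind (tr? S)))
        (trans (cong (ind (tr? S) *_) (eq S)) (tr-size g S))))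
    (∑-*ʳ (ind ∘ tr?) (g n) _)

  module _ (pt? : ∀ T → Dec (PartialTransversal L 1 T)) (max? : ∀ T → Dec (MaximalPT L 1 T)) where

    extensions : Sub n → ℕ
    extensions T = ∑ λ (e : Cell n) → ind (¬? (e ∈E? T)) * ind (tr? (addE T e))

    pt≤ : ∀ T → ind (pt? T) ≤ ind (max? T) + extensions T
    pt≤ T = by (pt? T) (max? T) (extensions T) refl
      where
      by : (d : Dec (PartialTransversal L 1 T)) (m : Dec (MaximalPT L 1 T)) →
           ∀ k → extensions T ≡ k → ind d ≤ ind m + k
      by (no _)   _        _       _  = z≤n
      by (yes _)  (yes _)  _       _  = s≤s z≤n
      by (yes _)  (no _)   (suc _) _  = s≤s z≤n
      -- Zero extensions would make T maximal, so an extending cell never has to be exhibited.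
      by (yes pt) (no ¬m)  zero    eq = contradiction (pt , maximal) ¬m
        where
        maximal : ∀ e → e ∉E T → ¬ AtMostOnce L (addE T e)
        maximal e e∉ amo with () ← trans (sym (cong₂ _*_ (ind-yes (¬? (e ∈E? T)) e∉)
          (ind-yes (tr? (addE T e)) (NearTransversal.extension-size L n>0 pt e e∉ , amo))))
          (∑≡0⇒ {xs = elems} eq (complete e))

    -- The extensions of all T total t n, as each transversal has n entries to delete.
    pt-bound : ∑Sub {n} (ind ∘ pt?) ≤ ∑Sub {n} (ind ∘ max?) + t * n
    pt-bound = ≤-trans (∑-mono _ pt≤) (≤-reflexive (trans (∑-+ _ _ _)
      (cong (∑Sub {n} (ind ∘ max?) +_)
        (trans (sym (∑∑-toggle {n} (λ _ S _ → ind (tr? S))))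
               (∑-weight (λ S e → ind (e ∈E? S)) id (sym ∘ size≡count {n}))))))

  module _ (nc? : ∀ S → Dec (NCover L S)) (min? : ∀ S → Dec (MinNCover L S)) where

    Shrinks : Sub n → Cell n → Set
    Shrinks S e = e ∈E S × Transversal L (removeE S e)

    shrinks? : ∀ S e → Dec (Shrinks S e)
    shrinks? S e = (e ∈E? S) ×-dec tr? (removeE S e)

    shrinks⇒nCover : ∀ {S e} → Shrinks S e → NCover L S
    shrinks⇒nCover {S} {e} (e∈ , tr) =
        (λ ℓ → let x , x∈ , on = transversal⇒cover tr ℓ in x , proj₁ (∈-remove⁻ S e x x∈) , on)
      , trans (size-remove S e e∈) (cong suc (proj₁ tr))

    -- Deleting either entry leaves a cover, so both are centres, and the doubled row and column
    -- have only one cell in common.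
    shrinks-unique : ∀ {S} → NCover L S → ∀ {e e′} → Shrinks S e → Shrinks S e′ → e′ ≡ e
    shrinks-unique nc (e∈ , tr) (e′∈ , tr′) = latin L {ρ} {κ} (λ ())
      (trans (proj₂ (c′ ρ)) (sym (proj₂ (c ρ)))) (trans (proj₂ (c′ κ)) (sym (proj₂ (c κ))))
      where
      open NearCover L nc
      c  = cover⇒centre e∈ (transversal⇒cover tr)
      c′ = cover⇒centre e′∈ (transversal⇒cover tr′)

    min+shrinks≤ : ∀ S → ind (min? S) + count (shrinks? S) ≤ ind (nc? S)
    min+shrinks≤ S = by (nc? S) (min? S)
      where
      by : (d : Dec (NCover L S)) (m : Dec (MinNCover L S)) → ind m + count (shrinks? S) ≤ ind d
      by (no ¬nc) (yes m) = contradiction (proj₁ m) ¬nc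
      by (no ¬nc) (no _)  = ≤-reflexive (count-none (shrinks? S) λ e sh → ¬nc (shrinks⇒nCover {S} {e} sh))
      by (yes nc) (no _)  = count-≤1 (shrinks? S) (shrinks-unique nc)
      by (yes nc) (yes m) = ≤-reflexive (cong suc (count-none (shrinks? S)
        λ e (e∈ , tr) → proj₂ (proj₂ m) e e∈ (transversal⇒cover tr)))

    nCover-bound : ∑Sub {n} (ind ∘ min?) + t * (n * n ∸ n) ≤ ∑Sub {n} (ind ∘ nc?)
    nCover-bound = ≤-trans (≤-reflexive (trans
      (cong (∑Sub {n} (ind ∘ min?) +_) (sym shrinks-total)) (sym (∑-+ _ _ _)))) (∑-mono _ min+shrinks≤)
      where
      outside-count : ∀ S → count (λ (e : Cell n) → ¬? (e ∈E? S)) ≡ n * n ∸ ∣ S ∣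
      outside-count S = trans (sym (m+n∸m≡n ∣ S ∣ _)) (cong (_∸ ∣ S ∣) (complement-size S))
      shrinks-total : ∑Sub {n} (λ S → count (shrinks? S)) ≡ t * (n * n ∸ n)
      shrinks-total = trans (∑-cong _ λ S → ∑-cong _ λ e → ind-× (e ∈E? S) (tr? (removeE S e)))
        (trans (∑∑-toggle {n} (λ _ _ T → ind (tr? T)))
          (∑-weight (λ S e → ind (¬? (e ∈E? S))) (n * n ∸_) outside-count))

-- Arithmetic of the bounds

open import Data.Integer using (+_) renaming (_+_ to _+ℤ_; _-_ to _-ℤ_; _*_ to _*ℤ_; _≤_ to _≤ℤ_)
import Data.Integer as ℤ
import Data.Integer.Properties as ℤ
import Data.Integer.Tactic.RingSolver as ℤ-Solver

-- Writing n = 3 + m turns the truncated differences 3n ∸ 4, 3n ∸ 6 and n² ∸ n into subtraction-free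
-- expressions.
module Arithmetic (m : ℕ) where

  private
    N = 3 + m

  3n∸4 : 3 * N ∸ 4 ≡ 3 * m + 5
  3n∸4 = trans (cong (_∸ 4) (expand m)) (m+n∸n≡m (3 * m + 5) 4)
    where
    expand : ∀ m → 3 * (3 + m) ≡ 3 * m + 5 + 4
    expand = solve-∀

  3n∸6 : 3 * N ∸ 6 ≡ 3 * m + 3
  3n∸6 = trans (cong (_∸ 6) (expand m)) (m+n∸n≡m (3 * m + 3) 6)
    where
    expand : ∀ m → 3 * (3 + m) ≡ 3 * m + 3 + 6
    expand = solve-∀

  n²∸n : N * N ∸ N ≡ (3 + m) * (2 + m)
  n²∸n = trans (cong (_∸ N) (expand m)) (m+n∸n≡m ((3 + m) * (2 + m)) N)
    where
    expand : ∀ m → (3 + m) * (3 + m) ≡ (3 + m) * (2 + m) + (3 + m)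
    expand = solve-∀

  module _ (r q₂ q₃ q₅ : ℕ)
    (pairs : 4 * q₂ + 8 * q₃ + 12 * q₅ ≡ r * (6 * N)) (adjacent : 2 * q₃ + 6 * q₅ ≡ r * 6) where

    private
      s = q₂ + q₃ + q₅

      sum-eq : 2 * s + (2 * q₃ + 4 * q₅) ≡ (3 * m + 9) * r
      sum-eq = *-cancelˡ-≡ _ _ 2 (trans (left q₂ q₃ q₅) (trans pairs (right m r)))
        where
        left : ∀ a b c → 2 * (2 * (a + b + c) + (2 * b + 4 * c)) ≡ 4 * a + 8 * b + 12 * c
        left = solve-∀
        right : ∀ m r → r * (6 * (3 + m)) ≡ 2 * ((3 * m + 9) * r)
        right = solve-∀

      -- Two thirds of `adjacent` reads 4r = (4/3) q₃ + 4 q₅; the comparison is made after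
      -- multiplying by 3.
      4r≤ : 4 * r ≤ 2 * q₃ + 4 * q₅
      4r≤ = *-cancelˡ-≤ 3 (begin
        3 * (4 * r)                ≡⟨ twelve r ⟩
        2 * (r * 6)                ≡⟨ cong (2 *_) adjacent ⟨
        2 * (2 * q₃ + 6 * q₅)      ≤⟨ m≤m+n _ (2 * q₃) ⟩
        2 * (2 * q₃ + 6 * q₅) + 2 * q₃ ≡⟨ regroup q₃ q₅ ⟩
        3 * (2 * q₃ + 4 * q₅)      ∎)
        where
        open ≤-Reasoning
        twelve : ∀ r → 3 * (4 * r) ≡ 2 * (r * 6)
        twelve = solve-∀
        regroup : ∀ b c → 2 * (2 * b + 6 * c) + 2 * b ≡ 3 * (2 * b + 4 * c)
        regroup = solve-∀

    lower : 2 * s ≤ (3 * m + 5) * r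
    lower = +-cancelʳ-≤ (4 * r) _ _ (begin
      2 * s + 4 * r                  ≤⟨ +-monoʳ-≤ (2 * s) 4r≤ ⟩
      2 * s + (2 * q₃ + 4 * q₅)      ≡⟨ sum-eq ⟩
      (3 * m + 9) * r                ≡⟨ regroup m r ⟩
      (3 * m + 5) * r + 4 * r        ∎)
      where
      open ≤-Reasoning
      regroup : ∀ m r → (3 * m + 9) * r ≡ (3 * m + 5) * r + 4 * r
      regroup = solve-∀

    upper : (3 * m + 3) * r ≤ 2 * s
    upper = +-cancelʳ-≤ (r * 6) _ _ (begin
      (3 * m + 3) * r + r * 6        ≡⟨ regroup m r ⟩
      (3 * m + 9) * r                ≡⟨ sum-eq ⟨
      2 * s + (2 * q₃ + 4 * q₅)      ≤⟨ +-monoʳ-≤ (2 * s) (+-monoʳ-≤ (2 * q₃) (*-monoˡ-≤ q₅ {4} {6} (m≤m+n 4 2))) ⟩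
      2 * s + (2 * q₃ + 6 * q₅)      ≡⟨ cong (λ k → 2 * s + k) adjacent ⟩
      2 * s + r * 6                  ∎)
      where
      open ≤-Reasoning
      regroup : ∀ m r → (3 * m + 3) * r + r * 6 ≡ (3 * m + 9) * r
      regroup = solve-∀

  module _ {r s qmin t p q : ℕ} (upper : (3 * m + 3) * r ≤ 2 * s) (s≤qmin : s ≤ qmin)
    (p≤ : p ≤ r + t * N) (≤q : qmin + t * ((3 + m) * (2 + m)) ≤ q) where

    -- The last inequality with both sides moved so that no subtraction occurs:
    -- n (n - 4) = (m + 3) m - (m + 3).
    bound-ℕ : (3 * m + 3) * p + (m + 3) * t ≤ 2 * q + (m + 3) * m * t
    bound-ℕ = begin
      (3 * m + 3) * p + (m + 3) * t
        ≤⟨ +-monoˡ-≤ ((m + 3) * t) (*-monoʳ-≤ (3 * m + 3) p≤) ⟩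
      (3 * m + 3) * (r + t * (3 + m)) + (m + 3) * t
        ≡⟨ split m r t ⟩
      (3 * m + 3) * r + (m + 3) * (3 * m + 4) * t
        ≤⟨ +-monoˡ-≤ _ (≤-trans upper (*-monoʳ-≤ 2 s≤qmin)) ⟩
      2 * qmin + (m + 3) * (3 * m + 4) * t
        ≡⟨ merge m qmin t ⟩
      2 * (qmin + t * ((3 + m) * (2 + m))) + (m + 3) * m * t
        ≤⟨ +-monoˡ-≤ _ (*-monoʳ-≤ 2 ≤q) ⟩
      2 * q + (m + 3) * m * t ∎
      where
      open ≤-Reasoning
      split : ∀ m r t → (3 * m + 3) * (r + t * (3 + m)) + (m + 3) * t ≡
                        (3 * m + 3) * r + (m + 3) * (3 * m + 4) * t
      split = solve-∀
      merge : ∀ m a t → 2 * a + (m + 3) * (3 * m + 4) * t ≡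
                        2 * (a + t * ((3 + m) * (2 + m))) + (m + 3) * m * t
      merge = solve-∀

    -- Over the integers because n - 4 is negative at n = 3; adding (m + 3) t to both sides reduces
    -- it to `bound-ℕ`.
    bound-ℤ : + (3 * N ∸ 6) *ℤ + p ≤ℤ + 2 *ℤ + q +ℤ (+ N *ℤ (+ N -ℤ + 4)) *ℤ + t
    bound-ℤ = begin
      + (3 * N ∸ 6) *ℤ + p
        ≡⟨ cong (λ k → + k *ℤ + p) 3n∸6 ⟩
      + (3 * m + 3) *ℤ + p
        ≡⟨ ℤ.pos-* (3 * m + 3) p ⟨
      + ((3 * m + 3) * p)
        ≡⟨ cancel (+ ((3 * m + 3) * p)) (+ ((m + 3) * t)) ⟩
      + ((3 * m + 3) * p + (m + 3) * t) -ℤ + ((m + 3) * t)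
        ≤⟨ ℤ.+-monoˡ-≤ (ℤ.- + ((m + 3) * t)) (ℤ.+≤+ bound-ℕ) ⟩
      + (2 * q + (m + 3) * m * t) -ℤ + ((m + 3) * t)
        ≡⟨ cong₂ (λ a b → a -ℤ b) (cong₂ _+ℤ_ (ℤ.pos-* 2 q)
             (trans (ℤ.pos-* ((m + 3) * m) t) (cong (_*ℤ + t) (ℤ.pos-* (m + 3) m))))
             (ℤ.pos-* (m + 3) t) ⟩
      + 2 *ℤ + q +ℤ (+ m +ℤ + 3) *ℤ + m *ℤ + t -ℤ (+ m +ℤ + 3) *ℤ + t
        ≡⟨ regroup (+ m) (+ q) (+ t) ⟩
      + 2 *ℤ + q +ℤ ((+ 3 +ℤ + m) *ℤ ((+ 3 +ℤ + m) -ℤ + 4)) *ℤ + t ∎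
      where
      open ℤ.≤-Reasoning
      cancel : ∀ a b → a ≡ a +ℤ b -ℤ b
      cancel = ℤ-Solver.solve-∀
      regroup : ∀ m q t → + 2 *ℤ q +ℤ (m +ℤ + 3) *ℤ m *ℤ t -ℤ (m +ℤ + 3) *ℤ t ≡
                          + 2 *ℤ q +ℤ ((+ 3 +ℤ m) *ℤ ((+ 3 +ℤ m) -ℤ + 4)) *ℤ t
      regroup = ℤ-Solver.solve-∀

-- For n ≥ 3 the denominators 3n - 4 and 3n - 6 are positive, so the fractions are stated with
-- denominators cleared. The clause q₁ ≤ qmin carries the inequality 0 ≤ 2(qmin - q₁)/(3n - 4) and
-- makes `qmin ∸ q₁` the true difference.
theorem2p7 : (n : ℕ) → 3 ≤ n → (L : LatinSquare n) →
    (pmax qmin q₁ q₂ q₃ q₄ q₅ t p q : ℕ) →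
    NumberOf n (MaximalPT L 1) pmax →
    NumberOf n (MinNCover L) qmin →
    NumberOf n (CoverOfType L G₁) q₁ →
    NumberOf n (CoverOfType L G₂) q₂ →
    NumberOf n (CoverOfType L G₃) q₃ →
    NumberOf n (CoverOfType L G₄) q₄ →
    NumberOf n (CoverOfType L G₅) q₅ →
    NumberOf n (Transversal L) t →
    NumberOf n (PartialTransversal L 1) p →
    NumberOf n (NCover L) q →
    (qmin ≡ q₁ + q₂ + q₃ + q₅)
    × (q₁ ≤ qmin)
    × (2 * (qmin ∸ q₁) ≤ (3 * n ∸ 4) * pmax)
    × ((3 * n ∸ 6) * pmax ≤ 2 * (qmin ∸ q₁))
    × (2 * (qmin ∸ q₁) ≤ 2 * qmin)
    × ((+ (3 * n ∸ 6)) *ℤ (+ p)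
    ≤ℤ (+ 2) *ℤ (+ q) +ℤ ((+ n) *ℤ ((+ n) -ℤ (+ 4))) *ℤ (+ t))
theorem2p7 n@(suc (suc (suc m))) (s≤s (s≤s (s≤s z≤n))) L pmax qmin q₁ q₂ q₃ q₄ q₅ t p q
  cmax cmin c₁ c₂ c₃ c₄ c₅ ct cp cq =
    qmin-split
  , ≤-trans (m≤m+n q₁ (q₂ + q₃ + q₅)) (≤-reflexive (sym qmin≡))
  , subst₂ (λ a b → 2 * a ≤ b * pmax) (sym diff) (sym 3n∸4) (lower pmax q₂ q₃ q₅ pairs adjacent)
  , subst₂ (λ a b → b * pmax ≤ 2 * a) (sym diff) (sym 3n∸6) upper′
  , *-monoʳ-≤ 2 (m∸n≤m qmin q₁)
  , bound-ℤ upper′ (≤-trans (≤-reflexive (sym diff)) (m∸n≤m qmin q₁)) p≤ ≤q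
  where
  open Arithmetic m
  n>0 : 1 ≤ n
  n>0 = s≤s z≤n

  max? = number-decides {n} cmax
  min? = number-decides {n} cmin
  d₁? = number-decides {n} c₁
  d₂? = number-decides {n} c₂
  d₃? = number-decides {n} c₃
  d₅? = number-decides {n} c₅
  tr? = number-decides {n} ct

  open PairCounting L n>0 min? max?
  open TransversalCounting L n>0 tr?

  by-type : ∀ S → _
  by-type = pairs-by-type d₁? d₂? d₃? d₅?

  ∑-scaled : ∀ {P : Sub n → Set} {k} a (c : NumberOf n P k) →
             ∑Sub {n} (λ S → a * ind (number-decides {n} c S)) ≡ a * k
  ∑-scaled a c = trans (∑-*ˡ a (λ S → ind (number-decides {n} c S)) _) (cong (a *_) (sym (number-∑ {n} c)))

  qmin-split : qmin ≡ q₁ + q₂ + q₃ + q₅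
  qmin-split = begin
    qmin                              ≡⟨ number-∑ {n} cmin ⟩
    ∑Sub {n} (ind ∘ min?)             ≡⟨ ∑-cong _ (λ S → proj₁ (by-type S)) ⟩
    ∑Sub {n} (λ S → ind (d₁? S) + ind (d₂? S) + ind (d₃? S) + ind (d₅? S))
      ≡⟨ trans (∑-+ _ _ _) (cong (_+ ∑Sub {n} (ind ∘ d₅?))
           (trans (∑-+ _ _ _) (cong (_+ ∑Sub {n} (ind ∘ d₃?)) (∑-+ _ _ _)))) ⟩
    ∑Sub {n} (ind ∘ d₁?) + ∑Sub {n} (ind ∘ d₂?) + ∑Sub {n} (ind ∘ d₃?) + ∑Sub {n} (ind ∘ d₅?)
      ≡⟨ cong₂ _+_ (cong₂ _+_ (cong₂ _+_ (number-∑ {n} c₁) (number-∑ {n} c₂)) (number-∑ {n} c₃)) (number-∑ {n} c₅) ⟨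
    q₁ + q₂ + q₃ + q₅                 ∎
    where open ≡-Reasoning

  pairs : 4 * q₂ + 8 * q₃ + 12 * q₅ ≡ pmax * (6 * n)
  pairs = begin
    4 * q₂ + 8 * q₃ + 12 * q₅
      ≡⟨ cong₂ _+_ (cong₂ _+_ (∑-scaled 4 c₂) (∑-scaled 8 c₃)) (∑-scaled 12 c₅) ⟨
    ∑Sub {n} (λ S → 4 * ind (d₂? S)) + ∑Sub {n} (λ S → 8 * ind (d₃? S)) + ∑Sub {n} (λ S → 12 * ind (d₅? S))
      ≡⟨ trans (∑-+ _ _ _) (cong (_+ ∑Sub {n} (λ S → 12 * ind (d₅? S))) (∑-+ _ _ _)) ⟨
    ∑Sub {n} (λ S → 4 * ind (d₂? S) + 8 * ind (d₃? S) + 12 * ind (d₅? S))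
      ≡⟨ ∑-cong _ (λ S → proj₁ (proj₂ (by-type S))) ⟨
    _ ≡⟨ proj₁ (pairs-with-max (number-∑ {n} cmax)) ⟩
    pmax * (6 * n) ∎
    where open ≡-Reasoning

  adjacent : 2 * q₃ + 6 * q₅ ≡ pmax * 6
  adjacent = begin
    2 * q₃ + 6 * q₅
      ≡⟨ cong₂ _+_ (∑-scaled 2 c₃) (∑-scaled 6 c₅) ⟨
    ∑Sub {n} (λ S → 2 * ind (d₃? S)) + ∑Sub {n} (λ S → 6 * ind (d₅? S))
      ≡⟨ ∑-+ _ _ _ ⟨
    ∑Sub {n} (λ S → 2 * ind (d₃? S) + 6 * ind (d₅? S))
      ≡⟨ ∑-cong _ (λ S → proj₂ (proj₂ (by-type S))) ⟨
    _ ≡⟨ proj₂ (pairs-with-max (number-∑ {n} cmax)) ⟩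
    pmax * 6 ∎
    where open ≡-Reasoning

  qmin≡ : qmin ≡ q₁ + (q₂ + q₃ + q₅)
  qmin≡ = trans qmin-split (trans (cong (_+ q₅) (+-assoc q₁ q₂ q₃)) (+-assoc q₁ (q₂ + q₃) q₅))

  diff : qmin ∸ q₁ ≡ q₂ + q₃ + q₅
  diff = trans (cong (_∸ q₁) qmin≡) (m+n∸m≡n q₁ _)

  upper′ : (3 * m + 3) * pmax ≤ 2 * (q₂ + q₃ + q₅)
  upper′ = upper pmax q₂ q₃ q₅ pairs adjacent

  p≤ : p ≤ pmax + t * n
  p≤ = subst₂ _≤_ (sym (number-∑ {n} cp))
    (cong₂ (λ a b → a + b * n) (sym (number-∑ {n} cmax)) (sym (number-∑ {n} ct)))
    (pt-bound (number-decides {n} cp) max?)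

  ≤q : qmin + t * ((3 + m) * (2 + m)) ≤ q
  ≤q = subst₂ _≤_
    (cong₂ _+_ (sym (number-∑ {n} cmin)) (cong₂ _*_ (sym (number-∑ {n} ct)) n²∸n))
    (sym (number-∑ {n} cq))
    (nCover-bound (number-decides {n} cq) min?)
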